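{- Let $M$ be a matroid on a finite linearly ordered set $E$ and let $B$ be a basis of $M$. The active filtration of $B$ is the unique filtration $\emptyset=F'_\varepsilon\subset\dots\subset F'_0=F_c=F_0\subset\dots\subset F_\iota=E$ of $E$ (and also the unique connected filtration of $M$) such that: - for all $1\le k\le\iota$, the set $B_k=B\cap(F_k\setminus F_{k-1})$ is a uniactive internal basis of the minor $M_k=M(F_k)/F_{k-1}$; - for all $1\le k\le\varepsilon$, the set $B'_k=B\cap(F'_{k-1}\setminus F'_k)$ is a uniactive external basis of the minor $M'_k=M(F'_{k-1})/F'_k$. In particular, the active filtration of $B$ is a connected filtration of $M$. Moreover, for this filtration, for $1\le k\le\iota$, if $M(F_k)/F_{k-1}$ is an isthmus then $B_k$ equals this isthmus, and, for $1\le k\le\varepsilon$, if $M(F'_{k-1})/F'_k$ is a loop then $B'_k=\emptyset$.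
   Context: $\subset$ denotes strict inclusion. For $A\subseteq G\subseteq E$, $M(G)/A$ is the minor obtained by restricting $M$ to $G$ and contracting $A$, with the induced order on its ground set. A matroid is called an isthmus, resp. a loop, if it has exactly one element and that element is a coloop, resp. a loop. One-element matroids are connected. For a basis $B$ of $M$: for $b\in B$, $C^*(B;b)$ is the fundamental cocircuit (the unique cocircuit contained in $(E\setminus B)\cup\{b\}$), and for $e\in E\setminus B$, $C(B;e)$ is the fundamental circuit (the unique circuit contained in $B\cup\{e\}$). $\mathrm{Int}(B)=\{b\in B: b=\min C^*(B;b)\}$ and $\mathrm{Ext}(B)=\{e\in E\setminus B: e=\min C(B;e)\}$. A basis is uniactive internal if $|\mathrm{Int}|=1$ and $\mathrm{Ext}=\emptyset$, and uniactive external if $\mathrm{Int}=\emptyset$ and $|\mathrm{Ext}|=1$ (the unique active element is then the minimum of the ground set). Filtrations. A filtration of $E$ (or of $M$) is a sequence $(F'_\varepsilon,\dots,F'_0,F_c,F_0,\dots,F_\iota)$ of subsets of $E$ ($\iota,\varepsilon\ge 0$) such that $\emptyset=F'_\varepsilon\subset\dots\subset F'_0=F_c=F_0\subset\dots\subset F_\iota=E$, the sequence $\min(F_k\setminus F_{k-1})$, $1\le k\le\iota$, is increasing with $k$, and the sequence $\min(F'_{k-1}\setminus F'_k)$, $1\le k\le\varepsilon$, is increasing with $k$. It is a connected filtration of $M$ if in addition $M(F_k)/F_{k-1}$ is connected and not a loop for $1\le k\le\iota$, and $M(F'_{k-1})/F'_k$ is connected and not an isthmus for $1\le k\le\varepsilon$.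 Active closure. For $b\in B$ let $C^*(B;b)^<=\{e\in C^*(B;b): e<b\}$, and for $e\in E\setminus B$ let $C(B;e)^<=\{b\in C(B;e): b<e\}$. For $X\subseteq\mathrm{Int}(B)$, $\mathrm{acl}(X)$ is the smallest subset of $E$ (for inclusion) such that $X\subseteq\mathrm{acl}(X)$; if $b\in B\cap\mathrm{acl}(X)$ then $C^*(B;b)\subseteq\mathrm{acl}(X)$; and if $b\in B$ and $\emptyset\ne C^*(B;b)^<\subseteq\mathrm{acl}(X)$ then $b\in\mathrm{acl}(X)$. For $X\subseteq\mathrm{Ext}(B)$, $\mathrm{acl}(X)$ is the smallest subset of $E$ such that $X\subseteq\mathrm{acl}(X)$; if $e\in (E\setminus B)\cap\mathrm{acl}(X)$ then $C(B;e)\subseteq\mathrm{acl}(X)$; and if $e\in E\setminus B$ and $\emptyset\ne C(B;e)^<\subseteq\mathrm{acl}(X)$ then $e\in\mathrm{acl}(X)$. Active filtration. Let $a_1<\dots<a_\iota$ be the elements of $\mathrm{Int}(B)$ and $a'_1<\dots<a'_\varepsilon$ those of $\mathrm{Ext}(B)$. The active filtration of $B$ is the sequence $(F'_\varepsilon,\dots,F'_0,F_c,F_0,\dots,F_\iota)$ with $F_c=\mathrm{acl}(\mathrm{Ext}(B))=E\setminus\mathrm{acl}(\mathrm{Int}(B))$ (these two sets are equal); $F_\iota=E$ and $F_k=E\setminus\mathrm{acl}(\{a_{k+1},\dots,a_\iota\})$ for $0\le k\le\iota-1$; $F'_\varepsilon=\emptyset$ and $F'_k=\mathrm{acl}(\{a'_{k+1},\dots,a'_\varepsilon\})$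 for $0\le k\le\varepsilon-1$ (and $F_0=F'_0=F_c$). -}

module Defs where

open import Data.Nat.Base as ℕ using (ℕ; zero; suc)
import Data.Nat.Properties as ℕ
import Data.Nat.Induction as ℕ
open import Data.Fin.Base using (Fin; zero; suc; inject₁; _≤_; _<_)
open import Data.Fin.Properties using (any?; all?; _≤?_; _<?_; _≟_)
open import Data.Fin.Subset
open import Data.Fin.Subset.Properties
open import Data.Vec.Base
  using (Vec; []; _∷_; map; tabulate; lookup; head; last; _∷ʳ_)
open import Data.Vec.Properties
  using (lookup∘tabulate; []=⇒lookup; lookup⇒[]=)
open import Data.Product.Base using (∃; _×_; _,_; proj₁; proj₂)
open import Data.Sum.Base using (_⊎_; inj₁; inj₂; [_,_]′)
open import Data.Empty using (⊥-elim)
open import Function.Base using (_∘_; _∘′_)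
open import Induction.WellFounded using (Acc; acc)
open import Relation.Nullary.Decidable
  using (Dec; yes; no; does; map′; ¬?; _×-dec_; _→-dec_; decidable-stable; dec-true)
open import Relation.Nullary.Negation using (¬_; contradiction)
open import Relation.Unary using (Pred; Decidable)
open import Relation.Binary.PropositionalEquality
open import Level using (0ℓ)

private variable
  n : ℕ

------------------------------------------------------------------------
-- Subsets of Fin n

allSubset? : {P : Pred (Subset n) 0ℓ} → Decidable P → Dec (∀ A → P A)
allSubset? P? = map′
  (λ ¬∃ A → decidable-stable (P? A) (λ ¬p → ¬∃ (A , ¬p)))
  (λ ∀P (A , ¬p) → ¬p (∀P A))
  (¬? (anySubset? (¬? ∘ P?)))

setOf : (P : Pred (Fin n) 0ℓ) → Decidable P → Subset n
setOf P P? = tabulate (does ∘ P?)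

module _ (P : Pred (Fin n) 0ℓ) (P? : Decidable P) where

  ∈-setOf⁺ : ∀ {x} → P x → x ∈ setOf P P?
  ∈-setOf⁺ {x} p = lookup⇒[]= x _
    (trans (lookup∘tabulate (does ∘ P?) x) (dec-true (P? x) p))

  ∈-setOf⁻ : ∀ {x} → x ∈ setOf P P? → P x
  ∈-setOf⁻ {x} x∈ with P? x | trans (sym (lookup∘tabulate (does ∘ P?) x)) ([]=⇒lookup x∈)
  ... | yes p | _  = p
  ... | no _  | ()

IsMin : Fin n → Subset n → Set
IsMin x A = x ∈ A × (∀ y → y ∈ A → x ≤ y)

isMin? : (x : Fin n) (A : Subset n) → Dec (IsMin x A)
isMin? x A = (x ∈? A) ×-dec all? (λ y → (y ∈? A) →-dec (x ≤? y))

below : Subset n → Fin n → Subset n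
below A x = setOf (λ y → y ∈ A × y < x) (λ y → (y ∈? A) ×-dec (y <? x))

-- In increasing order.
elements : (A : Subset n) → Vec (Fin n) ∣ A ∣
elements []            = []
elements (inside  ∷ A) = zero ∷ map suc (elements A)
elements (outside ∷ A) = map suc (elements A)

-- If a₁ < … < aₘ are the elements of A and k counts from 0, this is
-- {aₖ₊₁ , … , aₘ}.
elementsFrom : (A : Subset n) → Fin ∣ A ∣ → Subset n
elementsFrom A k = setOf
  (λ x → ∃ λ j → k ≤ j × x ≡ lookup (elements A) j)
  (λ x → any? (λ j → (k ≤? j) ×-dec (x ≟ lookup (elements A) j)))

private
  ─-∉ : ∀ {p q : Subset n} {x} → x ∈ p ─ q → x ∉ q
  ─-∉ {p = inside  ∷ p} {outside ∷ q} {zero} x∈ ()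
  ─-∉ {p = outside ∷ p} {outside ∷ q} {zero} () x∈q
  ─-∉ {p = s ∷ p} {inside ∷ q} {zero} () x∈q
  ─-∉ {p = s ∷ p} {t ∷ q} {suc x} x∈ x∈q = ─-∉ {p = p} (drop-there x∈) (drop-there x∈q)

  ∣∩∣+∣─∣ : (p q : Subset n) → ∣ p ∣ ≡ ∣ p ∩ q ∣ ℕ.+ ∣ p ─ q ∣
  ∣∩∣+∣─∣ [] [] = refl
  ∣∩∣+∣─∣ (outside ∷ p) (inside  ∷ q) = ∣∩∣+∣─∣ p q
  ∣∩∣+∣─∣ (outside ∷ p) (outside ∷ q) = ∣∩∣+∣─∣ p q
  ∣∩∣+∣─∣ (inside  ∷ p) (inside  ∷ q) = cong suc (∣∩∣+∣─∣ p q)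
  ∣∩∣+∣─∣ (inside  ∷ p) (outside ∷ q) =
    trans (cong suc (∣∩∣+∣─∣ p q)) (sym (ℕ.+-suc _ _))

  -- A union of disjoint sets inside r.
  disjoint-≤ : ∀ {p q r : Subset n} → p ⊆ r → q ⊆ r → (∀ {x} → x ∈ p → x ∉ q) →
               ∣ p ∣ ℕ.+ ∣ q ∣ ℕ.≤ ∣ r ∣
  disjoint-≤ {p = p} {q} {r} p⊆r q⊆r dis = begin
    ∣ p ∣ ℕ.+ ∣ q ∣          ≤⟨ ℕ.+-mono-≤
                                 (p⊆q⇒∣p∣≤∣q∣ (λ x∈p → x∈p∩q⁺ (p⊆r x∈p , x∈p)))
                                 (p⊆q⇒∣p∣≤∣q∣ (λ x∈q → x∈p∧x∉q⇒x∈p─q (q⊆r x∈q) (λ x∈p → dis x∈p x∈q))) ⟩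
    ∣ r ∩ p ∣ ℕ.+ ∣ r ─ p ∣  ≡⟨ ∣∩∣+∣─∣ r p ⟨
    ∣ r ∣                    ∎
    where open ℕ.≤-Reasoning

  ∣∪∣-≤ : (p q : Subset n) → ∣ p ∪ q ∣ ℕ.≤ ∣ p ∣ ℕ.+ ∣ q ∣
  ∣∪∣-≤ p q = begin
    ∣ p ∪ q ∣                            ≡⟨ ∣∩∣+∣─∣ (p ∪ q) p ⟩
    ∣ (p ∪ q) ∩ p ∣ ℕ.+ ∣ (p ∪ q) ─ p ∣  ≤⟨ ℕ.+-mono-≤ (∣p∩q∣≤∣q∣ (p ∪ q) p) (p⊆q⇒∣p∣≤∣q∣ in-q) ⟩
    ∣ p ∣ ℕ.+ ∣ q ∣                      ∎
    where
    open ℕ.≤-Reasoning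
    in-q : (p ∪ q) ─ p ⊆ q
    in-q x∈ with x∈p∪q⁻ p q (p─q⊆p (p ∪ q) p x∈)
    ... | inj₁ x∈p = ⊥-elim (─-∉ {p = p ∪ q} x∈ x∈p)
    ... | inj₂ x∈q = x∈q

  ∪⁅⁆-⊆ : ∀ {p q : Subset n} {x} → p ⊆ q → x ∈ q → p ∪ ⁅ x ⁆ ⊆ q
  ∪⁅⁆-⊆ {p = p} {x = x} p⊆q x∈q y∈ with x∈p∪q⁻ p ⁅ x ⁆ y∈
  ... | inj₁ y∈p = p⊆q y∈p
  ... | inj₂ y∈x rewrite x∈⁅y⁆⇒x≡y x y∈x = x∈q

  ∪-⊆ : ∀ {p q r : Subset n} → p ⊆ r → q ⊆ r → p ∪ q ⊆ r
  ∪-⊆ {p = p} {q} p⊆r q⊆r x∈ = [ p⊆r , q⊆r ]′ (x∈p∪q⁻ p q x∈)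

  ⊂-∪⁅⁆ : ∀ {p : Subset n} {x} → x ∉ p → p ⊂ p ∪ ⁅ x ⁆
  ⊂-∪⁅⁆ {p = p} {x} x∉p =
    p⊆p∪q ⁅ x ⁆ , x , q⊆p∪q p ⁅ x ⁆ (x∈⁅x⁆ x) , x∉p

------------------------------------------------------------------------
-- Matroids

-- The ground set is a subset of Fin n, so that minors of M live over the
-- same Fin n and inherit its order.

record Matroid (n : ℕ) : Set₁ where
  field
    E       : Subset n
    Indep   : Pred (Subset n) 0ℓ
    indep?  : Decidable Indep
    indep⊆E : ∀ {I} → Indep I → I ⊆ E
    indep-⊥ : Indep ⊥
    indep-↓ : ∀ {I J} → J ⊆ I → Indep I → Indep J
    augment : ∀ {I J} → Indep I → Indep J → ∣ I ∣ ℕ.< ∣ J ∣ →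
              ∃ λ x → x ∈ J × x ∉ I × Indep (I ∪ ⁅ x ⁆)

open Matroid public

IsBasis : Matroid n → Subset n → Set
IsBasis M B = Indep M B × (∀ J → Indep M J → B ⊆ J → J ⊆ B)

isBasis? : (M : Matroid n) → Decidable (IsBasis M)
isBasis? M B = indep? M B ×-dec
  allSubset? (λ J → indep? M J →-dec ((B ⊆? J) →-dec (J ⊆? B)))

IsCircuit : Matroid n → Subset n → Set
IsCircuit M C = C ⊆ E M × ¬ Indep M C × (∀ D → D ⊂ C → Indep M D)

isCircuit? : (M : Matroid n) → Decidable (IsCircuit M)
isCircuit? M C = (C ⊆? E M) ×-dec ¬? (indep? M C) ×-dec
  allSubset? (λ D → (D ⊂? C) →-dec indep? M D)

module _ (M : Matroid n) where

  private
    extend : ∀ {I} → Acc ℕ._<_ (n ℕ.∸ ∣ I ∣) → Indep M I → ∃ λ B → IsBasis M B × I ⊆ B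
    extend {I} (acc rec) i with anySubset? (λ J → indep? M J ×-dec (I ⊂? J))
    ... | yes (J , j , I⊂J) =
      let B , b , J⊆B = extend (rec (ℕ.∸-monoʳ-< (p⊂q⇒∣p∣<∣q∣ I⊂J) (∣p∣≤n J))) j
      in  B , b , J⊆B ∘′ proj₁ I⊂J
    ... | no ∄J = I , (i , maximal) , λ x∈ → x∈
      where
      maximal : ∀ J → Indep M J → I ⊆ J → J ⊆ I
      maximal J j I⊆J {x} x∈J =
        decidable-stable (x ∈? I) (λ x∉I → ∄J (J , j , I⊆J , x , x∈J , x∉I))

  extendToBasis : ∀ {I} → Indep M I → ∃ λ B → IsBasis M B × I ⊆ B
  extendToBasis = extend (ℕ.<-wellFounded _)

  indep≤basis : ∀ {B I} → IsBasis M B → Indep M I → ∣ I ∣ ℕ.≤ ∣ B ∣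
  indep≤basis {B} (b , maximal) i = ℕ.≮⇒≥ λ B<I →
    let x , _ , x∉B , Bx = augment M b i B<I
    in  x∉B (maximal _ Bx (p⊆p∪q ⁅ x ⁆) (q⊆p∪q B ⁅ x ⁆ (x∈⁅x⁆ x)))

  private
    large⇒basis : ∀ {B K} → IsBasis M B → Indep M K → ∣ B ∣ ℕ.≤ ∣ K ∣ → IsBasis M K
    large⇒basis {B} {K} b k B≤K = k , λ J j K⊆J {x} x∈J →
      decidable-stable (x ∈? K) λ x∉K →
        ℕ.<⇒≱ (p⊂q⇒∣p∣<∣q∣ (K⊆J , x , x∈J , x∉K)) (ℕ.≤-trans (indep≤basis b j) B≤K)

    grow : ∀ {I J} → Acc ℕ._<_ (n ℕ.∸ ∣ I ∣) → Indep M I → Indep M J →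
           ∃ λ K → Indep M K × I ⊆ K × K ⊆ I ∪ J × ∣ J ∣ ℕ.≤ ∣ K ∣
    grow {I} {J} (acc rec) i j with ∣ J ∣ ℕ.≤? ∣ I ∣
    ... | yes J≤I = I , i , (λ x∈ → x∈) , p⊆p∪q J , J≤I
    ... | no  J≰I =
      let x , x∈J , x∉I , Ix = augment M i j (ℕ.≰⇒> J≰I)
          K , k , Ix⊆K , K⊆ , J≤K =
            grow {J = J} (rec (ℕ.∸-monoʳ-< (p⊂q⇒∣p∣<∣q∣ (⊂-∪⁅⁆ x∉I)) (∣p∣≤n (I ∪ ⁅ x ⁆)))) Ix j
      in  K , k , Ix⊆K ∘′ p⊆p∪q ⁅ x ⁆
          , ∪-⊆ (∪⁅⁆-⊆ (p⊆p∪q J) (q⊆p∪q I J x∈J)) (q⊆p∪q I J) ∘′ K⊆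
          , J≤K

  extendWithin : ∀ {I B} → Indep M I → IsBasis M B →
                 ∃ λ K → IsBasis M K × I ⊆ K × K ⊆ I ∪ B
  extendWithin i b =
    let K , k , I⊆K , K⊆ , B≤K = grow (ℕ.<-wellFounded _) i (proj₁ b)
    in  K , large⇒basis b k B≤K , I⊆K , K⊆

dual : Matroid n → Matroid n
dual M .E         = E M
dual M .Indep X   = ∃ λ B → IsBasis M B × X ⊆ E M ─ B
dual M .indep? X  = anySubset? (λ B → isBasis? M B ×-dec (X ⊆? (E M ─ B)))
dual M .indep⊆E (B , _ , X⊆) = p─q⊆p (E M) B ∘′ X⊆
dual M .indep-⊥ = let B , b , _ = extendToBasis M (indep-⊥ M) in B , b , ⊥⊆
dual M .indep-↓ Y⊆X (B , b , X⊆) = B , b , X⊆ ∘′ Y⊆X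
dual M .augment {X} {Y} (B , b , X⊆) (B′ , b′ , Y⊆) X<Y =
  finish (any? λ y → (y ∈? Y) ×-dec ¬? (y ∈? X) ×-dec ¬? (y ∈? K))
  where
  ext : ∃ λ K → IsBasis M K × B′ ─ X ⊆ K × K ⊆ (B′ ─ X) ∪ B
  ext = extendWithin M (indep-↓ M (p─q⊆p B′ X) (proj₁ b′)) b
  K : Subset _
  K = proj₁ ext
  K∌X : ∀ {x} → x ∈ X → x ∉ K
  K∌X x∈X x∈K with x∈p∪q⁻ (B′ ─ X) B (proj₂ (proj₂ (proj₂ ext)) x∈K)
  ... | inj₁ x∈─ = ─-∉ {p = B′} x∈─ x∈X
  ... | inj₂ x∈B = ─-∉ {p = E M} (X⊆ x∈X) x∈B
  ∩X : ∣ B′ ∩ X ∣ ℕ.≤ ∣ X ─ Y ∣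
  ∩X = p⊆q⇒∣p∣≤∣q∣ λ x∈ → let x∈B′ , x∈X = x∈p∩q⁻ B′ X x∈ in
    x∈p∧x∉q⇒x∈p─q x∈X (λ x∈Y → ─-∉ {p = E M} (Y⊆ x∈Y) x∈B′)
  X─Y<Y─X : ∣ X ─ Y ∣ ℕ.< ∣ Y ─ X ∣
  X─Y<Y─X = ℕ.+-cancelˡ-< ∣ X ∩ Y ∣ _ _ (subst₂ ℕ._<_ (∣∩∣+∣─∣ X Y)
    (trans (∣∩∣+∣─∣ Y X) (cong (λ Z → ∣ Z ∣ ℕ.+ ∣ Y ─ X ∣) (∩-comm Y X))) X<Y)
  finish : Dec (∃ λ y → y ∈ Y × y ∉ X × y ∉ K) →
           ∃ λ y → y ∈ Y × y ∉ X × Indep (dual M) (X ∪ ⁅ y ⁆)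
  finish (yes (y , y∈Y , y∉X , y∉K)) = y , y∈Y , y∉X , K , proj₁ (proj₂ ext) ,
    ∪⁅⁆-⊆ (λ x∈X → x∈p∧x∉q⇒x∈p─q (p─q⊆p (E M) B (X⊆ x∈X)) (K∌X x∈X))
          (x∈p∧x∉q⇒x∈p─q (p─q⊆p (E M) B′ (Y⊆ y∈Y)) y∉K)
  finish (no ∄y) = contradiction
    (indep≤basis M b′ (proj₁ (proj₁ (proj₂ ext))))
    (ℕ.<⇒≱ (begin-strict
      ∣ B′ ∣                         ≡⟨ ∣∩∣+∣─∣ B′ X ⟩
      ∣ B′ ∩ X ∣ ℕ.+ ∣ B′ ─ X ∣      ≤⟨ ℕ.+-monoˡ-≤ _ ∩X ⟩
      ∣ X ─ Y ∣ ℕ.+ ∣ B′ ─ X ∣       <⟨ ℕ.+-monoˡ-< _ X─Y<Y─X ⟩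
      ∣ Y ─ X ∣ ℕ.+ ∣ B′ ─ X ∣       ≤⟨ disjoint-≤ Y─X⊆K (proj₁ (proj₂ (proj₂ ext)))
                                         (λ x∈ x∈′ → ─-∉ {p = E M} (Y⊆ (p─q⊆p Y X x∈)) (p─q⊆p B′ X x∈′)) ⟩
      ∣ K ∣                          ∎))
    where
    open ℕ.≤-Reasoning
    Y─X⊆K : Y ─ X ⊆ K
    Y─X⊆K {y} y∈ = decidable-stable (y ∈? K)
      (λ y∉K → ∄y (y , p─q⊆p Y X y∈ , ─-∉ {p = Y} y∈ , y∉K))

IsCocircuit : Matroid n → Subset n → Set
IsCocircuit M = IsCircuit (dual M)

restrict : Matroid n → Subset n → Matroid n
restrict M G .E = E M ∩ G
restrict M G .Indep I = Indep M I × I ⊆ G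
restrict M G .indep? I = indep? M I ×-dec (I ⊆? G)
restrict M G .indep⊆E (i , I⊆G) x∈ = x∈p∩q⁺ (indep⊆E M i x∈ , I⊆G x∈)
restrict M G .indep-⊥ = indep-⊥ M , ⊥⊆
restrict M G .indep-↓ J⊆I (i , I⊆G) = indep-↓ M J⊆I i , I⊆G ∘′ J⊆I
restrict M G .augment (i , I⊆G) (j , J⊆G) I<J =
  let x , x∈J , x∉I , Ix = augment M i j I<J
  in  x , x∈J , x∉I , Ix , ∪⁅⁆-⊆ I⊆G (J⊆G x∈J)

contract : Matroid n → Subset n → Matroid n
contract M A .E = E M ─ A
contract M A .Indep I =
  I ⊆ E M ─ A × ∃ λ K → IsBasis (restrict M A) K × Indep M (I ∪ K)
contract M A .indep? I = (I ⊆? (E M ─ A)) ×-dec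
  anySubset? (λ K → isBasis? (restrict M A) K ×-dec indep? M (I ∪ K))
contract M A .indep⊆E = proj₁
contract M A .indep-⊥ =
  let K , k , _ = extendToBasis (restrict M A) (indep-⊥ (restrict M A))
  in  ⊥⊆ , K , k , indep-↓ M (∪-⊆ ⊥⊆ (λ x∈ → x∈)) (proj₁ (proj₁ k))
contract M A .indep-↓ {I} J⊆I (I⊆ , K , k , i) =
  I⊆ ∘′ J⊆I , K , k , indep-↓ M (∪-⊆ (p⊆p∪q K ∘′ J⊆I) (q⊆p∪q I K)) i
contract M A .augment {I} {J} (I⊆ , K , k , i) (J⊆ , L , l , j) I<J =
  step (augment M i j IK<JL)
  where
  open ℕ.≤-Reasoning
  dis : ∀ {x} → x ∈ J → x ∉ L
  dis x∈J x∈L = ─-∉ {p = E M} (J⊆ x∈J) (proj₂ (proj₁ l) x∈L)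
  IK<JL : ∣ I ∪ K ∣ ℕ.< ∣ J ∪ L ∣
  IK<JL = begin-strict
    ∣ I ∪ K ∣        ≤⟨ ∣∪∣-≤ I K ⟩
    ∣ I ∣ ℕ.+ ∣ K ∣  <⟨ ℕ.+-mono-<-≤ I<J (indep≤basis (restrict M A) l (proj₁ k)) ⟩
    ∣ J ∣ ℕ.+ ∣ L ∣  ≤⟨ disjoint-≤ (p⊆p∪q L) (q⊆p∪q J L) dis ⟩
    ∣ J ∪ L ∣        ∎
  step : (∃ λ x → x ∈ J ∪ L × x ∉ I ∪ K × Indep M ((I ∪ K) ∪ ⁅ x ⁆)) →
         ∃ λ x → x ∈ J × x ∉ I × Indep (contract M A) (I ∪ ⁅ x ⁆)
  step (x , x∈JL , x∉IK , ind) with x∈p∪q⁻ J L x∈JL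
  ... | inj₁ x∈J = x , x∈J , x∉IK ∘′ p⊆p∪q K , ∪⁅⁆-⊆ I⊆ (J⊆ x∈J) , K , k ,
    indep-↓ M (∪-⊆ (∪⁅⁆-⊆ (p⊆p∪q ⁅ x ⁆ ∘′ p⊆p∪q K) (q⊆p∪q (I ∪ K) ⁅ x ⁆ (x∈⁅x⁆ x)))
                   (p⊆p∪q ⁅ x ⁆ ∘′ q⊆p∪q I K)) ind
  ... | inj₂ x∈L = ⊥-elim (x∉IK (q⊆p∪q I K (proj₂ k (K ∪ ⁅ x ⁆)
    ( indep-↓ M (∪⁅⁆-⊆ (p⊆p∪q ⁅ x ⁆ ∘′ q⊆p∪q I K) (q⊆p∪q (I ∪ K) ⁅ x ⁆ (x∈⁅x⁆ x))) ind
    , ∪⁅⁆-⊆ (proj₂ (proj₁ k)) (proj₂ (proj₁ l) x∈L))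
    (p⊆p∪q ⁅ x ⁆) (q⊆p∪q K ⁅ x ⁆ (x∈⁅x⁆ x)))))

-- M(G)/A
minor : Matroid n → Subset n → Subset n → Matroid n
minor M G A = contract (restrict M G) A

-- Any two distinct elements lie on a common circuit.
IsConnected : Matroid n → Set
IsConnected M = ∀ x y → x ∈ E M → y ∈ E M → x ≢ y →
  ∃ λ C → IsCircuit M C × x ∈ C × y ∈ C

-- One-element matroids, as opposed to elements of a matroid.
IsLoop IsIsthmus : Matroid n → Set
IsLoop    M = ∃ λ e → E M ≡ ⁅ e ⁆ × IsCircuit M ⁅ e ⁆
IsIsthmus M = ∃ λ e → E M ≡ ⁅ e ⁆ × IsCocircuit M ⁅ e ⁆

------------------------------------------------------------------------
-- Activities

module _ (M : Matroid n) (B : Subset n) where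

  -- C is C*(B;b), for a basis B and b ∈ B.
  IsFundCocircuit : Fin n → Subset n → Set
  IsFundCocircuit b C = IsCocircuit M C × C ⊆ (E M ─ B) ∪ ⁅ b ⁆

  -- C is C(B;e), for a basis B and e ∈ E ─ B.
  IsFundCircuit : Fin n → Subset n → Set
  IsFundCircuit e C = IsCircuit M C × C ⊆ B ∪ ⁅ e ⁆

  isFundCocircuit? : ∀ b → Decidable (IsFundCocircuit b)
  isFundCocircuit? b C = isCircuit? (dual M) C ×-dec (C ⊆? ((E M ─ B) ∪ ⁅ b ⁆))

  isFundCircuit? : ∀ e → Decidable (IsFundCircuit e)
  isFundCircuit? e C = isCircuit? M C ×-dec (C ⊆? (B ∪ ⁅ e ⁆))

  IsInternallyActive IsExternallyActive : Fin n → Set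
  IsInternallyActive b = b ∈ B × ∃ λ C → IsFundCocircuit b C × IsMin b C
  IsExternallyActive e = e ∈ E M ─ B × ∃ λ C → IsFundCircuit e C × IsMin e C

  isInternallyActive? : Decidable IsInternallyActive
  isInternallyActive? b = (b ∈? B) ×-dec
    anySubset? (λ C → isFundCocircuit? b C ×-dec isMin? b C)

  isExternallyActive? : Decidable IsExternallyActive
  isExternallyActive? e = (e ∈? (E M ─ B)) ×-dec
    anySubset? (λ C → isFundCircuit? e C ×-dec isMin? e C)

  Int Ext : Subset n
  Int = setOf IsInternallyActive isInternallyActive?
  Ext = setOf IsExternallyActive isExternallyActive?

  IsUniactiveInternal IsUniactiveExternal : Set
  IsUniactiveInternal = IsBasis M B × ∣ Int ∣ ≡ 1 × Ext ≡ ⊥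
  IsUniactiveExternal = IsBasis M B × Int ≡ ⊥ × ∣ Ext ∣ ≡ 1

------------------------------------------------------------------------
-- Active closure

-- The closure conditions on a subset A of G shared by the internal case
-- (S = B, with fundamental cocircuits) and the external case (S = E ─ B,
-- with fundamental circuits).  Fund s C means that C is the fundamental
-- (co)circuit of s, and below C s is C^<.

module Closure (G S : Subset n) {Fund : Fin n → Subset n → Set}
               (fund? : ∀ s → Decidable (Fund s)) (X : Subset n) where

  IsClosed : Subset n → Set
  IsClosed A =
      A ⊆ G
    × X ⊆ A
    × (∀ s C → s ∈ S → s ∈ A → Fund s C → C ⊆ A)
    × (∀ s C → s ∈ S → Fund s C → Nonempty (below C s) → below C s ⊆ A → s ∈ A)

  isClosed? : Decidable IsClosed
  isClosed? A = (A ⊆? G) ×-dec (X ⊆? A)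
    ×-dec all? (λ s → allSubset? (λ C →
            (s ∈? S) →-dec ((s ∈? A) →-dec (fund? s C →-dec (C ⊆? A)))))
    ×-dec all? (λ s → allSubset? (λ C →
            (s ∈? S) →-dec (fund? s C →-dec (nonempty? (below C s) →-dec
            ((below C s ⊆? A) →-dec (s ∈? A))))))

  -- The intersection of all closed sets; by the two lemmas below it is the
  -- smallest one.
  InEveryClosed : Fin n → Set
  InEveryClosed x = ∀ A → IsClosed A → x ∈ A

  inEveryClosed? : Decidable InEveryClosed
  inEveryClosed? x = allSubset? (λ A → isClosed? A →-dec (x ∈? A))

  acl : Subset n
  acl = setOf InEveryClosed inEveryClosed?

  acl-least : ∀ A → IsClosed A → acl ⊆ A
  acl-least A cl x∈ = ∈-setOf⁻ _ inEveryClosed? x∈ A cl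

  acl-closed : S ⊆ G → X ⊆ G → (∀ s C → Fund s C → C ⊆ G) → IsClosed acl
  acl-closed S⊆G X⊆G F⊆G =
      acl-least G ((λ x∈ → x∈) , X⊆G , (λ s C _ _ → F⊆G s C) , (λ s C s∈S _ _ _ → S⊆G s∈S))
    , (λ x∈X → ∈-setOf⁺ _ inEveryClosed? λ A cl → proj₁ (proj₂ cl) x∈X)
    , (λ s C s∈S s∈ f x∈C → ∈-setOf⁺ _ inEveryClosed? λ A cl →
         proj₁ (proj₂ (proj₂ cl)) s C s∈S (acl-least A cl s∈) f x∈C)
    , (λ s C s∈S f ne C⊆ → ∈-setOf⁺ _ inEveryClosed? λ A cl →
         proj₂ (proj₂ (proj₂ cl)) s C s∈S f ne (acl-least A cl ∘′ C⊆))

aclInt aclExt : Matroid n → Subset n → Subset n → Subset n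
aclInt M B = Closure.acl (E M) B         (isFundCocircuit? M B)
aclExt M B = Closure.acl (E M) (E M ─ B) (isFundCircuit? M B)

------------------------------------------------------------------------
-- Filtrations

-- lookup F′ k is F'ₖ and lookup F k is Fₖ; thus F′ is listed in the order
-- F'₀ , … , F'_ε, opposite to the order in which filtrations are written.

record SetSequence (n : ℕ) : Set where
  constructor setSequence
  field
    ε ι : ℕ
    F′  : Vec (Subset n) (suc ε)
    Fc  : Subset n
    F   : Vec (Subset n) (suc ι)

  -- An index k below stands for the index k + 1 of the mathematical text:
  -- step k is Fₖ₊₁ ─ Fₖ and step′ k is F'ₖ ─ F'ₖ₊₁.

  step : Fin ι → Subset n
  step k = lookup F (suc k) ─ lookup F (inject₁ k)

  step′ : Fin ε → Subset n
  step′ k = lookup F′ (inject₁ k) ─ lookup F′ (suc k)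

  stepMinor : Matroid n → Fin ι → Matroid n
  stepMinor M k = minor M (lookup F (suc k)) (lookup F (inject₁ k))

  stepMinor′ : Matroid n → Fin ε → Matroid n
  stepMinor′ M k = minor M (lookup F′ (inject₁ k)) (lookup F′ (suc k))

open SetSequence public

IncreasingMins : ∀ {m} → (Fin m → Subset n) → Set
IncreasingMins S = ∀ j k → j < k → ∀ x y → IsMin x (S j) → IsMin y (S k) → x < y

record IsFiltration (G : Subset n) (𝓕 : SetSequence n) : Set where
  field
    F′-last  : last (F′ 𝓕) ≡ ⊥
    F′-chain : ∀ k → lookup (F′ 𝓕) (suc k) ⊂ lookup (F′ 𝓕) (inject₁ k)
    F′-head  : head (F′ 𝓕) ≡ Fc 𝓕
    F-head   : head (F 𝓕) ≡ Fc 𝓕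
    F-chain  : ∀ k → lookup (F 𝓕) (inject₁ k) ⊂ lookup (F 𝓕) (suc k)
    F-last   : last (F 𝓕) ≡ G
    mins     : IncreasingMins (step 𝓕)
    mins′    : IncreasingMins (step′ 𝓕)

record IsConnectedFiltration (M : Matroid n) (𝓕 : SetSequence n) : Set where
  field
    isFiltration : IsFiltration (E M) 𝓕
    connected    : ∀ k → IsConnected (stepMinor 𝓕 M k) × ¬ IsLoop (stepMinor 𝓕 M k)
    connected′   : ∀ k → IsConnected (stepMinor′ 𝓕 M k) × ¬ IsIsthmus (stepMinor′ 𝓕 M k)

UniactiveSteps : Matroid n → Subset n → SetSequence n → Set
UniactiveSteps M B 𝓕 =
    (∀ k → IsUniactiveInternal (stepMinor 𝓕 M k) (B ∩ step 𝓕 k))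
  × (∀ k → IsUniactiveExternal (stepMinor′ 𝓕 M k) (B ∩ step′ 𝓕 k))

activeFiltration : Matroid n → Subset n → SetSequence n
activeFiltration M B = setSequence
  ∣ Ext M B ∣
  ∣ Int M B ∣
  (tabulate (λ k → aclExt M B (elementsFrom (Ext M B) k)) ∷ʳ ⊥)
  (aclExt M B (Ext M B))
  (tabulate (λ k → E M ─ aclInt M B (elementsFrom (Int M B) k)) ∷ʳ E M)

{-# OPTIONS --safe #-}

-- Let b ~ e when e ∈ C*(B;b), equivalently b ∈ C(B;e).  An element is active when
-- it precedes all its neighbours in this bipartite fundamental graph.  If B ∩ A and
-- B ∩ G are bases of M(A) and M(G), then the fundamental graph of B ∩ (G ─ A) in
-- M(G)/A is the subgraph induced on G ─ A, so filtrations can be studied in the graph.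
-- Membership in an active closure is decided by recursion along the order: b joins
-- when it is a generator or has smaller neighbours, all of which have joined, and e
-- joins when one of its smaller neighbours has.  The same recursion forces the terms
-- of every filtration with uniactive steps, which gives uniqueness; it also makes
-- acl(Int) and acl(Ext) complementary, as each step negates the other.  Finally, in a
-- uniactive minor every nonactive element lies on a common circuit with a smaller one,
-- and lying on a common circuit is transitive, so the minor is connected.
-- Transposing the graph exchanges the internal and the external case.
module Submission where

open import Data.Nat.Base as ℕ using (ℕ; zero; suc; z≤n; s≤s)
import Data.Nat.Properties as ℕ
import Data.Nat.Induction as ℕ
open import Data.Fin.Base as Fin using (Fin; zero; suc; toℕ; fromℕ; inject₁; _<_)
import Data.Fin.Properties as Fin
import Data.Fin.Induction as Fin
open import Data.Fin.Subset
open import Data.Fin.Subset.Properties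
open import Data.Vec.Base using (Vec; []; _∷_; lookup; here; there; head; last; _∷ʳ_; tabulate; initLast)
open import Data.Vec.Properties using (lookup-map; tabulate∘lookup; tabulate-cong)
open import Data.Product.Base using (∃; _×_; _,_; proj₁; proj₂)
open import Data.Sum.Base as Sum using (_⊎_; inj₁; inj₂; [_,_]′)
import Data.Empty as Empty
open import Function.Base using (_∘_; _∘′_; id; flip)
open import Induction.WellFounded using (Acc; acc)
open import Relation.Nullary.Decidable
  using (Dec; yes; no; ¬?; _×-dec_; _→-dec_; decidable-stable; map′)
open import Relation.Nullary.Negation using (¬_; contradiction)
open import Relation.Unary using (Decidable)
open import Relation.Binary.Definitions using (tri<; tri≈; tri>)
open import Relation.Binary.PropositionalEquality
open import Defs

-- The two halves of a filtration cannot be treated separately. A closure stays outside `Fₖ` only if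
-- no element of `B` inside `F_c` can be drawn in through its smaller neighbours. Such an element
-- keeps a smaller neighbour inside `F_c`, because an external step gives one to each of its basis
-- elements. This is the hypothesis `outside-smaller`, which each half supplies to the other.
-- Reading a minor M(G)/A off the graph needs `B ∩ A` and `B ∩ G` to be bases of A and G, which is
-- not part of the assumptions on a filtration. It is recovered upwards from the empty set: a basis
-- of A and a basis of the minor combine to a basis of G. The increasing minima make the active
-- element of a step the least element of everything from that step on. This is why it is active in
-- the whole graph and not only in its own minor. Existence and uniqueness meet in
-- `IsActiveSequence`, a description of the terms by closures that determines them, holds for the
-- active filtration, and follows from uniactive steps.

private variable
  m n : ℕ

-- Finite sets

x∈p─q⇒x∉q : ∀ {p q : Subset n} {x} → x ∈ p ─ q → x ∉ q
x∈p─q⇒x∉q {p = _ ∷ _} {inside ∷ q} {zero} () _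
x∈p─q⇒x∉q {p = _ ∷ _} {outside ∷ q} {zero} _ ()
x∈p─q⇒x∉q {p = _ ∷ p} {_ ∷ q} {suc x} x∈ x∈q =
  x∈p─q⇒x∉q {p = p} (drop-there x∈) (drop-there x∈q)

x∈p─q⇒x∈p : ∀ {p q : Subset n} {x} → x ∈ p ─ q → x ∈ p
x∈p─q⇒x∈p {p = p} {q} = p─q⊆p p q

x∈p∩q⇒x∈p : ∀ {p q : Subset n} {x} → x ∈ p ∩ q → x ∈ p
x∈p∩q⇒x∈p {p = p} {q} = p∩q⊆p p q

x∈p∩q⇒x∈q : ∀ {p q : Subset n} {x} → x ∈ p ∩ q → x ∈ q
x∈p∩q⇒x∈q {p = p} {q} = p∩q⊆q p q

x∈p-y⇒x≢y : ∀ {p : Subset n} {x y} → x ∈ p - y → x ≢ y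
x∈p-y⇒x≢y {p = p} {y = y} x∈ refl = x∈p─q⇒x∉q {p = p} x∈ (x∈⁅x⁆ y)

x∈p∪⁅y⁆⁻ : ∀ {p : Subset n} {x y} → x ∈ p ∪ ⁅ y ⁆ → x ≢ y → x ∈ p
x∈p∪⁅y⁆⁻ {p = p} {y = y} x∈ x≢y with x∈p∪q⁻ p ⁅ y ⁆ x∈
... | inj₁ x∈p = x∈p
... | inj₂ x∈y = contradiction (x∈⁅y⁆⇒x≡y y x∈y) x≢y

y∈p∪⁅y⁆ : ∀ {p : Subset n} {y} → y ∈ p ∪ ⁅ y ⁆
y∈p∪⁅y⁆ {p = p} {y} = q⊆p∪q p ⁅ y ⁆ (x∈⁅x⁆ y)

x∈p⇒x∈p∪⁅y⁆ : ∀ {p : Subset n} {x y} → x ∈ p → x ∈ p ∪ ⁅ y ⁆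
x∈p⇒x∈p∪⁅y⁆ {y = y} = p⊆p∪q ⁅ y ⁆

∪-lub : ∀ {p q r : Subset n} → p ⊆ r → q ⊆ r → p ∪ q ⊆ r
∪-lub {p = p} {q} p⊆r q⊆r x∈ = [ p⊆r , q⊆r ]′ (x∈p∪q⁻ p q x∈)

∪⁅⁆-lub : ∀ {p r : Subset n} {y} → p ⊆ r → y ∈ r → p ∪ ⁅ y ⁆ ⊆ r
∪⁅⁆-lub {p = p} {r} {y} p⊆r y∈r = ∪-lub p⊆r (λ x∈y → subst (_∈ r) (sym (x∈⁅y⁆⇒x≡y y x∈y)) y∈r)

∪-mono : ∀ {p q r s : Subset n} → p ⊆ q → r ⊆ s → p ∪ r ⊆ q ∪ s
∪-mono {q = q} {s = s} p⊆q r⊆s = ∪-lub (p⊆p∪q s ∘′ p⊆q) (q⊆p∪q q s ∘′ r⊆s)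

⊆∧∣∣≥⇒⊇ : ∀ {p q : Subset n} → p ⊆ q → ∣ q ∣ ℕ.≤ ∣ p ∣ → q ⊆ p
⊆∧∣∣≥⇒⊇ {p = p} p⊆q q≤p {x} x∈q = decidable-stable (x ∈? p) λ x∉p →
  ℕ.<⇒≱ (p⊂q⇒∣p∣<∣q∣ (p⊆q , x , x∈q , x∉p)) q≤p

∣∪∣+∣∩∣ : (p q : Subset n) → ∣ p ∪ q ∣ ℕ.+ ∣ p ∩ q ∣ ≡ ∣ p ∣ ℕ.+ ∣ q ∣
∣∪∣+∣∩∣ [] [] = refl
∣∪∣+∣∩∣ (outside ∷ p) (outside ∷ q) = ∣∪∣+∣∩∣ p q
∣∪∣+∣∩∣ (outside ∷ p) (inside  ∷ q) = trans (cong suc (∣∪∣+∣∩∣ p q)) (sym (ℕ.+-suc _ _))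
∣∪∣+∣∩∣ (inside  ∷ p) (outside ∷ q) = cong suc (∣∪∣+∣∩∣ p q)
∣∪∣+∣∩∣ (inside  ∷ p) (inside  ∷ q) = cong suc
  (trans (ℕ.+-suc _ _) (trans (cong suc (∣∪∣+∣∩∣ p q)) (sym (ℕ.+-suc _ _))))

∣∪∣≤ : (p q : Subset n) → ∣ p ∪ q ∣ ℕ.≤ ∣ p ∣ ℕ.+ ∣ q ∣
∣∪∣≤ p q = subst (∣ p ∪ q ∣ ℕ.≤_) (∣∪∣+∣∩∣ p q) (ℕ.m≤m+n _ _)

disjoint⇒∣∪∣ : (p q : Subset n) → (∀ {x} → x ∈ p → x ∉ q) → ∣ p ∪ q ∣ ≡ ∣ p ∣ ℕ.+ ∣ q ∣
disjoint⇒∣∪∣ {n} p q p∌q = begin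
  ∣ p ∪ q ∣                    ≡⟨ ℕ.+-identityʳ _ ⟨
  ∣ p ∪ q ∣ ℕ.+ 0              ≡⟨ cong (∣ p ∪ q ∣ ℕ.+_) (∣⊥∣≡0 n) ⟨
  ∣ p ∪ q ∣ ℕ.+ ∣ ⊥ {n = n} ∣  ≡⟨ cong (λ r → ∣ p ∪ q ∣ ℕ.+ ∣ r ∣) (Empty-unique ∩-empty) ⟨
  ∣ p ∪ q ∣ ℕ.+ ∣ p ∩ q ∣      ≡⟨ ∣∪∣+∣∩∣ p q ⟩
  ∣ p ∣ ℕ.+ ∣ q ∣              ∎
  where
  open ≡-Reasoning
  ∩-empty : Empty (p ∩ q)
  ∩-empty (x , x∈) = let x∈p , x∈q = x∈p∩q⁻ p q x∈ in p∌q x∈p x∈q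

∣∪⁅⁆∣ : ∀ {p : Subset n} {x} → x ∉ p → ∣ p ∪ ⁅ x ⁆ ∣ ≡ suc ∣ p ∣
∣∪⁅⁆∣ {p = p} {x} x∉p = begin
  ∣ p ∪ ⁅ x ⁆ ∣        ≡⟨ disjoint⇒∣∪∣ p ⁅ x ⁆ (λ { y∈p y∈x → x∉p (subst (_∈ p) (x∈⁅y⁆⇒x≡y x y∈x) y∈p) }) ⟩
  ∣ p ∣ ℕ.+ ∣ ⁅ x ⁆ ∣  ≡⟨ cong (∣ p ∣ ℕ.+_) (∣⁅x⁆∣≡1 x) ⟩
  ∣ p ∣ ℕ.+ 1          ≡⟨ ℕ.+-comm _ 1 ⟩
  suc ∣ p ∣            ∎
  where open ≡-Reasoning

p⊆p-x∪⁅x⁆ : ∀ {p : Subset n} {x} → p ⊆ (p - x) ∪ ⁅ x ⁆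
p⊆p-x∪⁅x⁆ {p = p} {x} {y} y∈p with y Fin.≟ x
... | yes refl = y∈p∪⁅y⁆ {p = p - x}
... | no  y≢x  = x∈p⇒x∈p∪⁅y⁆ (x∈p∧x≢y⇒x∈p-y y∈p y≢x)

∣-∣ : ∀ {p : Subset n} {x} → x ∈ p → suc ∣ p - x ∣ ≡ ∣ p ∣
∣-∣ {p = p} {x} x∈p = trans
  (sym (∣∪⁅⁆∣ (λ x∈ → x∈p-y⇒x≢y {p = p} x∈ refl)))
  (cong ∣_∣ (⊆-antisym (∪⁅⁆-lub (p─q⊆p p ⁅ x ⁆) x∈p) p⊆p-x∪⁅x⁆))

_-_+_ : Subset n → Fin n → Fin n → Subset n
p - b + e = (p - b) ∪ ⁅ e ⁆

∈-+⁻ : ∀ {p : Subset n} {b e x} → x ∈ p - b + e → x ≢ e → x ∈ p × x ≢ b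
∈-+⁻ {p = p} x∈ x≢e = let x∈p-b = x∈p∪⁅y⁆⁻ x∈ x≢e in x∈p─q⇒x∈p {p = p} x∈p-b , x∈p-y⇒x≢y {p = p} x∈p-b

∈-+⁺ : ∀ {p : Subset n} {b e x} → x ∈ p → x ≢ b → x ∈ p - b + e
∈-+⁺ x∈p x≢b = x∈p⇒x∈p∪⁅y⁆ (x∈p∧x≢y⇒x∈p-y x∈p x≢b)

b∉-+ : ∀ {p : Subset n} {b e} → b ≢ e → b ∉ p - b + e
b∉-+ b≢e b∈ = proj₂ (∈-+⁻ b∈ b≢e) refl

∣-+∣ : ∀ {p : Subset n} {b e} → b ∈ p → e ∉ p → ∣ p - b + e ∣ ≡ ∣ p ∣
∣-+∣ {p = p} b∈p e∉p = trans (∣∪⁅⁆∣ (e∉p ∘ x∈p─q⇒x∈p {p = p})) (∣-∣ b∈p)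

-- Circuits and exchanges

module _ (M : Matroid n) where

  maxIndep : ∀ {B K} → IsBasis M B → Indep M K → ∣ B ∣ ℕ.≤ ∣ K ∣ → IsBasis M K
  maxIndep b k B≤K = k , λ J j K⊆J → ⊆∧∣∣≥⇒⊇ K⊆J (ℕ.≤-trans (indep≤basis M b j) B≤K)

  circuitWithin : ∀ {D} → D ⊆ E M → ¬ Indep M D → ∃ λ C → IsCircuit M C × C ⊆ D
  circuitWithin = go (ℕ.<-wellFounded _)
    where
    go : ∀ {D} → Acc ℕ._<_ ∣ D ∣ → D ⊆ E M → ¬ Indep M D → ∃ λ C → IsCircuit M C × C ⊆ D
    go {D} (acc rec) D⊆E ¬d with anySubset? (λ D′ → (D′ ⊂? D) ×-dec ¬? (indep? M D′))
    ... | yes (D′ , D′⊂D , ¬d′) =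
      let C , c , C⊆D′ = go (rec (p⊂q⇒∣p∣<∣q∣ D′⊂D)) (D⊆E ∘′ proj₁ D′⊂D) ¬d′
      in  C , c , proj₁ D′⊂D ∘′ C⊆D′
    ... | no ∄D′ = D
      , (D⊆E , ¬d , λ D′ D′⊂D → decidable-stable (indep? M D′) (λ ¬d′ → ∄D′ (D′ , D′⊂D , ¬d′)))
      , id

  circuit⊈indep : ∀ {C I} → IsCircuit M C → Indep M I → ¬ (C ⊆ I)
  circuit⊈indep (_ , ¬c , _) i C⊆I = ¬c (indep-↓ M C⊆I i)

  circuit-minus : ∀ {C x} → IsCircuit M C → x ∈ C → Indep M (C - x)
  circuit-minus (_ , _ , min) x∈C = min _ (x∈p⇒p-x⊂p x∈C)

  fundCircuit∋e : ∀ {B e C} → Indep M B → IsFundCircuit M B e C → e ∈ C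
  fundCircuit∋e {B} {e} {C} b (c , C⊆) = decidable-stable (e ∈? C) λ e∉C →
    circuit⊈indep c b λ x∈C → x∈p∪⁅y⁆⁻ (C⊆ x∈C) λ { refl → e∉C x∈C }

  -- The elements of C(B;e) other than e are the b that can be exchanged for e.
  Exchange : Subset n → Fin n → Fin n → Set
  Exchange B b e = b ∈ B × e ∈ E M ─ B × Indep M (B - b + e)

  module _ {B : Subset n} (basis : IsBasis M B) where

    exchange-basis : ∀ {b e} → Exchange B b e → IsBasis M (B - b + e)
    exchange-basis (b∈B , e∈ , i) =
      maxIndep basis i (ℕ.≤-reflexive (sym (∣-+∣ b∈B (x∈p─q⇒x∉q {p = E M} e∈))))

    -- Extend the independent set `C - x` to a basis `K` inside `(C - x) ∪ B`. It misses `x`, since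
    -- otherwise it would contain `C`; hence `K ⊆ B - x + e`, and the cardinalities force equality.
    ∈-fundCircuit⁻ : ∀ {e C x} → e ∈ E M ─ B → IsFundCircuit M B e C →
                     x ∈ C → x ≢ e → Exchange B x e
    ∈-fundCircuit⁻ {e} {C} {x} e∈ (c , C⊆) x∈C x≢e = x∈B , e∈ , indep-↓ M ⊆K (proj₁ k)
      where
      x∈B : x ∈ B
      x∈B = x∈p∪⁅y⁆⁻ (C⊆ x∈C) x≢e
      e∉B : e ∉ B
      e∉B = x∈p─q⇒x∉q {p = E M} e∈
      ext : ∃ λ K → IsBasis M K × C - x ⊆ K × K ⊆ (C - x) ∪ B
      ext = extendWithin M (circuit-minus c x∈C) basis
      K : Subset _
      K = proj₁ ext
      k : IsBasis M K
      k = proj₁ (proj₂ ext)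
      x∉K : x ∉ K
      x∉K x∈K = circuit⊈indep c (proj₁ k)
        (∪⁅⁆-lub (proj₁ (proj₂ (proj₂ ext))) x∈K ∘′ p⊆p-x∪⁅x⁆)
      K⊆ : K ⊆ B - x + e
      K⊆ {y} y∈K with y Fin.≟ e
      ... | yes refl = y∈p∪⁅y⁆ {p = B - x}
      ... | no  y≢e  = ∈-+⁺
        (x∈p∪⁅y⁆⁻ (∪-lub (C⊆ ∘′ x∈p─q⇒x∈p {p = C}) x∈p⇒x∈p∪⁅y⁆ (proj₂ (proj₂ (proj₂ ext)) y∈K)) y≢e)
        (λ { refl → x∉K y∈K })
      ⊆K : B - x + e ⊆ K
      ⊆K = ⊆∧∣∣≥⇒⊇ K⊆ (ℕ.≤-trans (ℕ.≤-reflexive (∣-+∣ x∈B e∉B)) (indep≤basis M k (proj₁ basis)))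

    ∈-fundCircuit⁺ : ∀ {e C x} → IsFundCircuit M B e C → Exchange B x e → x ∈ C
    ∈-fundCircuit⁺ {e} {C} {x} (c , C⊆) (_ , e∈ , i) = decidable-stable (x ∈? C) λ x∉C →
      circuit⊈indep c i λ {y} y∈C → case-e x∉C y∈C (y Fin.≟ e)
      where
      case-e : x ∉ C → ∀ {y} → y ∈ C → Dec (y ≡ e) → y ∈ B - x + e
      case-e x∉C y∈C (yes refl) = y∈p∪⁅y⁆ {p = B - x}
      case-e x∉C y∈C (no y≢e)   = ∈-+⁺ (x∈p∪⁅y⁆⁻ (C⊆ y∈C) y≢e) (λ { refl → x∉C y∈C })

    fundCircuit : ∀ {e} → e ∈ E M ─ B → ∃ (IsFundCircuit M B e)
    fundCircuit {e} e∈ =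
      let C , c , C⊆ = circuitWithin {B ∪ ⁅ e ⁆}
            (∪⁅⁆-lub (indep⊆E M (proj₁ basis)) (x∈p─q⇒x∈p {p = E M} e∈))
            (λ i → x∈p─q⇒x∉q {p = E M} e∈ (proj₂ basis _ i x∈p⇒x∈p∪⁅y⁆ (y∈p∪⁅y⁆ {p = B})))
      in  C , c , C⊆

    dual-basis : IsBasis (dual M) (E M ─ B)
    dual-basis = (B , basis , id) , λ J (B′ , b′ , J⊆) E─B⊆J {x} x∈J →
      x∈p∧x∉q⇒x∈p─q (x∈p─q⇒x∈p {p = E M} (J⊆ x∈J)) λ x∈B →
        x∈p─q⇒x∉q {p = E M} (J⊆ x∈J) (proj₂ b′ B (proj₁ basis) (λ {y} y∈B′ →
          decidable-stable (y ∈? B) λ y∉B →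
            x∈p─q⇒x∉q {p = E M} (J⊆ (E─B⊆J (x∈p∧x∉q⇒x∈p─q (indep⊆E M (proj₁ b′) y∈B′) y∉B))) y∈B′) x∈B)

    b∈E─[E─B] : ∀ {b} → b ∈ B → b ∈ E M ─ (E M ─ B)
    b∈E─[E─B] b∈B = x∈p∧x∉q⇒x∈p─q (indep⊆E M (proj₁ basis) b∈B)
      (λ b∈ → x∈p─q⇒x∉q {p = E M} b∈ b∈B)

    -- The conclusion is dual independence of `(E M ─ B) - e + b`, unfolded: exchanging `b` for `e`
    -- in `B` exchanges `e` for `b` in the complement.
    dual-exchange⁺ : ∀ {b e} → Exchange B b e → ∃ λ B′ → IsBasis M B′ × (E M ─ B) - e + b ⊆ E M ─ B′
    dual-exchange⁺ {b} {e} x@(b∈B , e∈ , _) = B - b + e , exchange-basis x , ∪⁅⁆-lub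
      (λ {y} y∈ → let y∈E─B = x∈p─q⇒x∈p {p = E M ─ B} y∈ in
        x∈p∧x∉q⇒x∈p─q (x∈p─q⇒x∈p {p = E M} y∈E─B) λ y∈′ →
          x∈p─q⇒x∉q {p = E M} y∈E─B (proj₁ (∈-+⁻ y∈′ (x∈p-y⇒x≢y {p = E M ─ B} y∈))))
      (x∈p∧x∉q⇒x∈p─q (indep⊆E M (proj₁ basis) b∈B)
        (b∉-+ λ { refl → x∈p─q⇒x∉q {p = E M} e∈ b∈B }))

    -- A basis disjoint from `(E M ─ B) - e + b` lies in `B - b + e`, which has the cardinality of a
    -- basis, so the two coincide.
    dual-exchange⁻ : ∀ {b e B′} → b ∈ B → e ∈ E M ─ B → IsBasis M B′ →
                     (E M ─ B) - e + b ⊆ E M ─ B′ → Indep M (B - b + e)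
    dual-exchange⁻ {b} {e} {B′} b∈B e∈ b′ ⊆E─B′ =
      indep-↓ M (⊆∧∣∣≥⇒⊇ B′⊆ (ℕ.≤-trans (ℕ.≤-reflexive (∣-+∣ b∈B (x∈p─q⇒x∉q {p = E M} e∈)))
                                           (indep≤basis M b′ (proj₁ basis)))) (proj₁ b′)
      where
      B′⊆ : B′ ⊆ B - b + e
      B′⊆ {y} y∈B′ with y Fin.≟ e
      ... | yes refl = y∈p∪⁅y⁆ {p = B - b}
      ... | no  y≢e  = ∈-+⁺
        (decidable-stable (y ∈? B) λ y∉B → x∈p─q⇒x∉q {p = E M}
          (⊆E─B′ (∈-+⁺ (x∈p∧x∉q⇒x∈p─q (indep⊆E M (proj₁ b′) y∈B′) y∉B) y≢e)) y∈B′)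
        λ { refl → x∈p─q⇒x∉q {p = E M} (⊆E─B′ (y∈p∪⁅y⁆ {p = (E M ─ B) - e})) y∈B′ }

module _ (M : Matroid n) {B : Subset n} (basis : IsBasis M B) where

  -- `IsFundCocircuit M B` unfolds to `IsFundCircuit (dual M) (E M ─ B)`, so the circuit lemmas
  -- apply in the dual; only the exchange has to be translated back.
  ∈-fundCocircuit⁻ : ∀ {b C x} → b ∈ B → IsFundCocircuit M B b C → x ∈ C → x ≢ b → Exchange M B b x
  ∈-fundCocircuit⁻ b∈B fund x∈C x≢b =
    let x∈ , _ , B′ , b′ , ⊆E─B′ =
          ∈-fundCircuit⁻ (dual M) (dual-basis M basis) (b∈E─[E─B] M basis b∈B) fund x∈C x≢b
    in  b∈B , x∈ , dual-exchange⁻ M basis b∈B x∈ b′ ⊆E─B′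

  ∈-fundCocircuit⁺ : ∀ {b C x} → IsFundCocircuit M B b C → Exchange M B b x → x ∈ C
  ∈-fundCocircuit⁺ fund ex@(b∈B , x∈ , _) =
    ∈-fundCircuit⁺ (dual M) (dual-basis M basis) fund
      (x∈ , b∈E─[E─B] M basis b∈B , dual-exchange⁺ M basis ex)

  fundCocircuit : ∀ {b} → b ∈ B → ∃ (IsFundCocircuit M B b)
  fundCocircuit b∈B = fundCircuit (dual M) (dual-basis M basis) (b∈E─[E─B] M basis b∈B)

  fundCocircuit∋b : ∀ {b C} → IsFundCocircuit M B b C → b ∈ C
  fundCocircuit∋b = fundCircuit∋e (dual M) (proj₁ (dual-basis M basis))

-- Minors

module _ (M : Matroid n) {B : Subset n} (basis : IsBasis M B) where

  -- A is spanned by B ∩ A: it contains C(B;e) for every e ∈ A ─ B.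
  Spanned : Subset n → Set
  Spanned A = ∀ {b e} → Exchange M B b e → e ∈ A → b ∈ A

  -- An independent subset of `A` that contains `B ∩ A` and an element of `A` outside `B` would
  -- contain the whole fundamental circuit of that element.
  spanned⇒basis : ∀ {A} → Spanned A → IsBasis (restrict M A) (B ∩ A)
  spanned⇒basis {A} spanned =
    (indep-↓ M (p∩q⊆p B A) (proj₁ basis) , p∩q⊆q B A) ,
    λ { J (j , J⊆A) B∩A⊆J {x} x∈J → x∈p∩q⁺ (decidable-stable (x ∈? B) (λ x∉B →
      let x∈ = x∈p∧x∉q⇒x∈p─q (indep⊆E M j x∈J) x∉B
          C , fund = fundCircuit M basis x∈
      in  circuit⊈indep M (proj₁ fund) j (C⊆J B∩A⊆J (J⊆A x∈J) x∈J x∈ fund)) , J⊆A x∈J) }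
    where
    C⊆J : ∀ {J x C} → B ∩ A ⊆ J → x ∈ A → x ∈ J → x ∈ E M ─ B → IsFundCircuit M B x C → C ⊆ J
    C⊆J {x = x} B∩A⊆J x∈A x∈J x∈ fund {y} y∈C with y Fin.≟ x
    ... | yes refl = x∈J
    ... | no  y≢x  =
      let ex = ∈-fundCircuit⁻ M basis x∈ fund y∈C y≢x
      in  B∩A⊆J (x∈p∩q⁺ (proj₁ ex , spanned ex x∈A))

  -- If `b` were outside `A`, then `(B ∩ A) ∪ ⁅ e ⁆` would lie in the independent set `B - b + e`,
  -- against the maximality of `B ∩ A`.
  basis⇒spanned : ∀ {A} → IsBasis (restrict M A) (B ∩ A) → Spanned A
  basis⇒spanned {A} (_ , maximal) {b} {e} (b∈B , e∈ , i) e∈A = decidable-stable (b ∈? A) λ b∉A →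
    x∈p─q⇒x∉q {p = E M} e∈ (x∈p∩q⇒x∈p {p = B} (maximal ((B ∩ A) ∪ ⁅ e ⁆)
      ( indep-↓ M (∪⁅⁆-lub (λ x∈ → ∈-+⁺ (x∈p∩q⇒x∈p {p = B} x∈) λ { refl → b∉A (x∈p∩q⇒x∈q {p = B} x∈) })
                           (y∈p∪⁅y⁆ {p = B - b})) i
      , ∪⁅⁆-lub (p∩q⊆q B A) e∈A)
      x∈p⇒x∈p∪⁅y⁆ (y∈p∪⁅y⁆ {p = B ∩ A})))

-- Independence in a contraction is defined through some basis of `A`; this shows that any other
-- basis serves as well. `I ∪ K` is a basis of `I ∪ A`. Extending `L` to a basis of `I ∪ A` adds
-- nothing from `A`, so the result lies in `I ∪ L`, and counting shows that it is all of it.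
contract-indep : (M : Matroid n) {A K L I : Subset n} →
                 IsBasis (restrict M A) K → IsBasis (restrict M A) L →
                 I ⊆ E M ─ A → Indep M (I ∪ K) → Indep M (I ∪ L)
contract-indep M {A} {K} {L} {I} k l I⊆ i = indep-↓ M I∪L⊆T (proj₁ (proj₁ t))
  where
  IA : Subset _
  IA = I ∪ A
  k-basis : IsBasis (restrict M IA) (I ∪ K)
  k-basis = (i , ∪-mono id (proj₂ (proj₁ k))) , λ { J (j , J⊆) I∪K⊆J {x} x∈J →
    Sum.[ p⊆p∪q K , (λ x∈A → q⊆p∪q I K (proj₂ k (J ∩ A)
      (indep-↓ M (p∩q⊆p J A) j , p∩q⊆q J A)
      (λ y∈K → x∈p∩q⁺ (I∪K⊆J (q⊆p∪q I K y∈K) , proj₂ (proj₁ k) y∈K))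
      (x∈p∩q⁺ (x∈J , x∈A)))) ]′ (x∈p∪q⁻ I A (J⊆ x∈J)) }
  ext : ∃ λ T → IsBasis (restrict M IA) T × L ⊆ T × T ⊆ L ∪ (I ∪ K)
  ext = extendWithin (restrict M IA)
    (proj₁ (proj₁ l) , q⊆p∪q I A ∘′ proj₂ (proj₁ l)) k-basis
  T : Subset _
  T = proj₁ ext
  t : IsBasis (restrict M IA) T
  t = proj₁ (proj₂ ext)
  T⊆ : T ⊆ I ∪ L
  T⊆ {x} x∈T = Sum.[ p⊆p∪q L , (λ x∈A → q⊆p∪q I L (proj₂ l (T ∩ A)
      (indep-↓ M (p∩q⊆p T A) (proj₁ (proj₁ t)) , p∩q⊆q T A)
      (λ y∈L → x∈p∩q⁺ (proj₁ (proj₂ (proj₂ ext)) y∈L , proj₂ (proj₁ l) y∈L))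
      (x∈p∩q⁺ (x∈T , x∈A)))) ]′ (x∈p∪q⁻ I A (proj₂ (proj₁ t) x∈T))
  I∪L⊆T : I ∪ L ⊆ T
  I∪L⊆T = ⊆∧∣∣≥⇒⊇ T⊆ (begin
    ∣ I ∪ L ∣        ≤⟨ ∣∪∣≤ I L ⟩
    ∣ I ∣ ℕ.+ ∣ L ∣  ≤⟨ ℕ.+-monoʳ-≤ ∣ I ∣ (indep≤basis (restrict M A) k (proj₁ l)) ⟩
    ∣ I ∣ ℕ.+ ∣ K ∣  ≡⟨ disjoint⇒∣∪∣ I K (λ x∈I x∈K → x∈p─q⇒x∉q {p = E M} (I⊆ x∈I) (proj₂ (proj₁ k) x∈K)) ⟨
    ∣ I ∪ K ∣        ≤⟨ indep≤basis (restrict M IA) t (proj₁ k-basis) ⟩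
    ∣ T ∣            ∎)
    where open ℕ.≤-Reasoning

module _ (M : Matroid n) {B A G : Subset n} (basis : IsBasis M B) (A⊆G : A ⊆ G) (G⊆E : G ⊆ E M)
         (A-basis : IsBasis (restrict M A) (B ∩ A)) where

  private
    A-basis′ : IsBasis (restrict (restrict M G) A) (B ∩ A)
    A-basis′ = ((indep-↓ M (p∩q⊆p B A) (proj₁ basis) , A⊆G ∘′ p∩q⊆q B A) , p∩q⊆q B A)
             , λ J (j , J⊆A) → proj₂ A-basis J (proj₁ j , J⊆A)

  E-minor : E (minor M G A) ≡ G ─ A
  E-minor = cong (_─ A) (⊆-antisym (p∩q⊆q (E M) G) (λ x∈G → x∈p∩q⁺ (G⊆E x∈G , x∈G)))

  minor-indep⁺ : ∀ {I} → I ⊆ G ─ A → Indep M (I ∪ (B ∩ A)) → Indep (minor M G A) I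
  minor-indep⁺ {I} I⊆ i = subst (I ⊆_) (sym E-minor) I⊆ , B ∩ A , A-basis′ ,
    i , ∪-lub (x∈p─q⇒x∈p {p = G} ∘′ I⊆) (A⊆G ∘′ p∩q⊆q B A)

  minor-indep⁻ : ∀ {I} → Indep (minor M G A) I → I ⊆ G ─ A × Indep M (I ∪ (B ∩ A))
  minor-indep⁻ {I} (I⊆ , K , k , i) = subst (I ⊆_) E-minor I⊆ ,
    proj₁ (contract-indep (restrict M G) k A-basis′ I⊆ i)

  minor-basis⁺ : IsBasis (restrict M G) (B ∩ G) → IsBasis (minor M G A) (B ∩ (G ─ A))
  minor-basis⁺ (_ , maximal) =
    minor-indep⁺ (p∩q⊆q B (G ─ A)) (indep-↓ M (∪-lub (p∩q⊆p B (G ─ A)) (p∩q⊆p B A)) (proj₁ basis)) ,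
    λ J j B∩⊆J {x} x∈J → let J⊆ , j′ = minor-indep⁻ j in
      x∈p∩q⁺ (x∈p∩q⇒x∈p {p = B} (maximal (J ∪ (B ∩ A))
        (j′ , ∪-lub (x∈p─q⇒x∈p {p = G} ∘′ J⊆) (A⊆G ∘′ p∩q⊆q B A))
        (λ {y} y∈ → let y∈B , y∈G = x∈p∩q⁻ B G y∈ in
          split (λ y∉A → B∩⊆J (x∈p∩q⁺ (y∈B , x∈p∧x∉q⇒x∈p─q y∈G y∉A))) y∈B (y ∈? A))
        (p⊆p∪q (B ∩ A) x∈J)) , J⊆ x∈J)
    where
    split : ∀ {J y} → (y ∉ A → y ∈ J) → y ∈ B → Dec (y ∈ A) → y ∈ J ∪ (B ∩ A)
    split {J} _ y∈B (yes y∈A) = q⊆p∪q J (B ∩ A) (x∈p∩q⁺ (y∈B , y∈A))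
    split     f _   (no  y∉A) = p⊆p∪q (B ∩ A) (f y∉A)

  -- An independent `J` in `G` above `B ∩ G` splits: maximality of `B ∩ A` controls `J ∩ A`, and
  -- maximality in the minor controls `J ─ A`. This carries the basis property from one term of a
  -- filtration to the next.
  minor-basis⁻ : IsBasis (minor M G A) (B ∩ (G ─ A)) → IsBasis (restrict M G) (B ∩ G)
  minor-basis⁻ (_ , maximal) =
    (indep-↓ M (p∩q⊆p B G) (proj₁ basis) , p∩q⊆q B G) ,
    λ J (j , J⊆G) B∩G⊆J {x} x∈J → x∈p∩q⁺ (in-B j J⊆G B∩G⊆J x∈J (x ∈? A) , J⊆G x∈J)
    where
    in-B : ∀ {J x} → Indep M J → J ⊆ G → B ∩ G ⊆ J → x ∈ J → Dec (x ∈ A) → x ∈ B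
    in-B {J} j J⊆G B∩G⊆J x∈J (yes x∈A) = x∈p∩q⇒x∈p {p = B} (proj₂ A-basis (J ∩ A)
      (indep-↓ M (p∩q⊆p J A) j , p∩q⊆q J A)
      (λ y∈ → let y∈B , y∈A = x∈p∩q⁻ B A y∈ in x∈p∩q⁺ (B∩G⊆J (x∈p∩q⁺ (y∈B , A⊆G y∈A)) , y∈A))
      (x∈p∩q⁺ (x∈J , x∈A)))
    in-B {J} j J⊆G B∩G⊆J x∈J (no x∉A) = x∈p∩q⇒x∈p {p = B} (maximal (J ─ A)
      (minor-indep⁺ (λ y∈ → x∈p∧x∉q⇒x∈p─q (J⊆G (x∈p─q⇒x∈p {p = J} y∈)) (x∈p─q⇒x∉q {p = J} y∈))
        (indep-↓ M (∪-lub (p─q⊆p J A) (λ y∈ →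
          let y∈B , y∈A = x∈p∩q⁻ B A y∈ in B∩G⊆J (x∈p∩q⁺ (y∈B , A⊆G y∈A)))) j))
      (λ y∈ → let y∈B , y∈G─A = x∈p∩q⁻ B (G ─ A) y∈ in
        x∈p∧x∉q⇒x∈p─q (B∩G⊆J (x∈p∩q⁺ (y∈B , x∈p─q⇒x∈p {p = G} y∈G─A))) (x∈p─q⇒x∉q {p = G} y∈G─A))
      (x∈p∧x∉q⇒x∈p─q x∈J x∉A))

  module _ (G-basis : IsBasis (restrict M G) (B ∩ G)) where

    exchange-minor⁺ : ∀ {b e} → b ∈ G ─ A → e ∈ G ─ A → Exchange M B b e →
                      Exchange (minor M G A) (B ∩ (G ─ A)) b e
    exchange-minor⁺ {b} {e} b∈ e∈ (b∈B , e∈E─B , i) =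
      x∈p∩q⁺ (b∈B , b∈) ,
      x∈p∧x∉q⇒x∈p─q (subst (e ∈_) (sym E-minor) e∈) (x∈p─q⇒x∉q {p = E M} e∈E─B ∘′ p∩q⊆p B (G ─ A)) ,
      minor-indep⁺
        (∪⁅⁆-lub (p∩q⊆q B (G ─ A) ∘′ p─q⊆p (B ∩ (G ─ A)) ⁅ b ⁆) e∈)
        (indep-↓ M (∪-lub
          (∪⁅⁆-lub (λ y∈ → ∈-+⁺ (x∈p∩q⇒x∈p {p = B} (x∈p─q⇒x∈p {p = B ∩ (G ─ A)} y∈))
                                (x∈p-y⇒x≢y {p = B ∩ (G ─ A)} y∈))
                   (y∈p∪⁅y⁆ {p = B - b}))
          (λ y∈ → ∈-+⁺ (x∈p∩q⇒x∈p {p = B} y∈)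
            λ { refl → x∈p─q⇒x∉q {p = G} b∈ (x∈p∩q⇒x∈q {p = B} y∈) })) i)

    -- Otherwise `B - b + e` contains a circuit, which is the fundamental circuit of `e`. As `B ∩ G`
    -- spans `G`, that circuit stays in `G`, hence in the exchanged set of the minor together with
    -- `B ∩ A`, which is independent.
    exchange-minor⁻ : ∀ {b e} → Exchange (minor M G A) (B ∩ (G ─ A)) b e → Exchange M B b e
    exchange-minor⁻ {b} {e} (b∈ , e∈ , i) = b∈B , e∈E─B ,
      decidable-stable (indep? M (B - b + e)) λ ¬i →
        let C , c , C⊆ = circuitWithin M
              (∪⁅⁆-lub (indep⊆E M (proj₁ basis) ∘′ p─q⊆p B ⁅ b ⁆) (x∈p─q⇒x∈p {p = E M} e∈E─B)) ¬i
        in  circuit⊈indep M c (proj₂ (minor-indep⁻ i)) (λ {x} x∈C → C⊆J c C⊆ x∈C (x Fin.≟ e) (x ∈? A))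
      where
      b∈B : b ∈ B
      b∈B = x∈p∩q⇒x∈p {p = B} b∈
      e∈G─A : e ∈ G ─ A
      e∈G─A = subst (e ∈_) E-minor (x∈p─q⇒x∈p {p = E (minor M G A)} e∈)
      e∈G : e ∈ G
      e∈G = x∈p─q⇒x∈p {p = G} e∈G─A
      e∈E─B : e ∈ E M ─ B
      e∈E─B = x∈p∧x∉q⇒x∈p─q (G⊆E e∈G) λ e∈B →
        x∈p─q⇒x∉q {p = E (minor M G A)} e∈ (x∈p∩q⁺ (e∈B , e∈G─A))
      C⊆J : ∀ {C x} → IsCircuit M C → C ⊆ B - b + e → x ∈ C → Dec (x ≡ e) → Dec (x ∈ A) →
            x ∈ (B ∩ (G ─ A)) - b + e ∪ (B ∩ A)
      C⊆J _ _ _ (yes refl) _ = p⊆p∪q (B ∩ A) (y∈p∪⁅y⁆ {p = (B ∩ (G ─ A)) - b})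
      C⊆J c C⊆ x∈C (no x≢e) x∈A? with ∈-+⁻ {p = B} (C⊆ x∈C) x≢e
      C⊆J c C⊆ x∈C (no x≢e) (yes x∈A) | x∈B , x≢b =
        q⊆p∪q ((B ∩ (G ─ A)) - b + e) (B ∩ A) (x∈p∩q⁺ (x∈B , x∈A))
      C⊆J c C⊆ x∈C (no x≢e) (no x∉A) | x∈B , x≢b =
        p⊆p∪q (B ∩ A) (∈-+⁺ (x∈p∩q⁺ (x∈B , x∈p∧x∉q⇒x∈p─q
          (basis⇒spanned M basis G-basis
            (∈-fundCircuit⁻ M basis e∈E─B
              (c , ∪-mono (p─q⊆p B ⁅ b ⁆) id ∘′ C⊆) x∈C x≢e) e∈G) x∉A)) x≢b)

-- Connectivity

module _ (M : Matroid n) where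

  -- The rest of the circuit lies in `I`, so `I` already spans `y` and no independent set above `I`
  -- can contain it.
  restrict-span : ∀ {S I C y} → IsBasis (restrict M S) I → IsCircuit M C → y ∈ C → C - y ⊆ I →
                  IsBasis (restrict M (S ∪ ⁅ y ⁆)) I
  restrict-span {S} {I} {C} {y} ((i , I⊆S) , maximal) c y∈C C-y⊆I =
    (i , x∈p⇒x∈p∪⁅y⁆ ∘′ I⊆S) , λ { J (j , J⊆) I⊆J → maximal J (j , λ {x} x∈J →
      x∈p∪⁅y⁆⁻ (J⊆ x∈J) λ { refl → circuit⊈indep M c j (∪⁅⁆-lub (I⊆J ∘′ C-y⊆I) x∈J ∘′ p⊆p-x∪⁅x⁆) }) I⊆J }

  -- A rank count with `S = (C ∪ D) - y - x`. The circuit `D` puts `y` in the span of `S`, and then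
  -- `C` puts `x` in the span of `S ∪ ⁅ y ⁆`. So a basis `I` of `S` becomes dependent on adding `x`,
  -- and a circuit in `I ∪ ⁅ x ⁆` must use `x`.
  strongElimination : ∀ {C D x y} → IsCircuit M C → IsCircuit M D → y ∈ C → y ∈ D → x ∈ C → x ∉ D →
                      ∃ λ C′ → IsCircuit M C′ × x ∈ C′ × C′ ⊆ (C ∪ D) - y
  strongElimination {C} {D} {x} {y} c d y∈C y∈D x∈C x∉D =
    let C′ , c′ , C′⊆ = circuitWithin M I∪x⊆E I∪x-dep in
      C′ , c′
    , decidable-stable (x ∈? C′) (λ x∉C′ → circuit⊈indep M c′ (proj₁ (proj₁ i))
        (λ z∈ → x∈p∪⁅y⁆⁻ (C′⊆ z∈) λ { refl → x∉C′ z∈ }))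
    , ∪⁅⁆-lub (λ z∈I → p─q⊆p ((C ∪ D) - y) ⁅ x ⁆ (proj₂ (proj₁ i) z∈I))
        (x∈p∧x≢y⇒x∈p-y (p⊆p∪q D x∈C) x≢y)
      ∘′ C′⊆
    where
    x≢y : x ≢ y
    x≢y refl = x∉D y∈D
    S : Subset _
    S = (C ∪ D) - y - x
    D-y⊆S : D - y ⊆ S
    D-y⊆S z∈ = let z∈D = x∈p─q⇒x∈p {p = D} z∈ in
      x∈p∧x≢y⇒x∈p-y (x∈p∧x≢y⇒x∈p-y (q⊆p∪q C D z∈D) (x∈p-y⇒x≢y {p = D} z∈)) λ { refl → x∉D z∈D }
    ext : ∃ λ I → IsBasis (restrict M S) I × D - y ⊆ I
    ext = extendToBasis (restrict M S) (circuit-minus M d y∈D , D-y⊆S)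
    I : Subset _
    I = proj₁ ext
    i : IsBasis (restrict M S) I
    i = proj₁ (proj₂ ext)
    I-basis : IsBasis (restrict M (S ∪ ⁅ y ⁆)) I
    I-basis = restrict-span i d y∈D (proj₂ (proj₂ ext))
    C-x⊆ : C - x ⊆ S ∪ ⁅ y ⁆
    C-x⊆ {z} z∈ with z Fin.≟ y
    ... | yes refl = y∈p∪⁅y⁆ {p = S}
    ... | no  z≢y  = x∈p⇒x∈p∪⁅y⁆ (x∈p∧x≢y⇒x∈p-y
      (x∈p∧x≢y⇒x∈p-y (p⊆p∪q D (x∈p─q⇒x∈p {p = C} z∈)) z≢y) (x∈p-y⇒x≢y {p = C} z∈))
    -- `I` need not contain `C - x`. A second basis of the same set that does contain it shows that
    -- `x` adds no rank; the two bases are compared by size.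
    extK : ∃ λ K → IsBasis (restrict M (S ∪ ⁅ y ⁆)) K × C - x ⊆ K
    extK = extendToBasis (restrict M (S ∪ ⁅ y ⁆)) (circuit-minus M c x∈C , C-x⊆)
    K-basis : IsBasis (restrict M ((S ∪ ⁅ y ⁆) ∪ ⁅ x ⁆)) (proj₁ extK)
    K-basis = restrict-span (proj₁ (proj₂ extK)) c x∈C (proj₂ (proj₂ extK))
    I∪x-dep : ¬ Indep M (I ∪ ⁅ x ⁆)
    I∪x-dep ix = ℕ.<⇒≱ (ℕ.n<1+n _) (begin
      suc ∣ I ∣          ≡⟨ ∣∪⁅⁆∣ (λ x∈I → x∈p-y⇒x≢y {p = (C ∪ D) - y} (proj₂ (proj₁ i) x∈I) refl) ⟨
      ∣ I ∪ ⁅ x ⁆ ∣      ≤⟨ indep≤basis (restrict M ((S ∪ ⁅ y ⁆) ∪ ⁅ x ⁆)) K-basis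
                              (ix , ∪-mono (proj₂ (proj₁ I-basis)) id) ⟩
      ∣ proj₁ extK ∣     ≤⟨ indep≤basis (restrict M (S ∪ ⁅ y ⁆)) I-basis (proj₁ (proj₁ (proj₂ extK))) ⟩
      ∣ I ∣              ∎)
      where open ℕ.≤-Reasoning
    I∪x⊆E : I ∪ ⁅ x ⁆ ⊆ E M
    I∪x⊆E = ∪⁅⁆-lub (indep⊆E M (proj₁ (proj₁ i))) (proj₁ c x∈C)

module _ (M : Matroid n) where

  OnCommonCircuit : Fin n → Fin n → Set
  OnCommonCircuit x y = ∃ λ C → IsCircuit M C × x ∈ C × y ∈ C

  meetingCircuits : ∀ {C D x y z} → IsCircuit M C → IsCircuit M D →
                    x ∈ C → y ∈ C → y ∈ D → z ∈ D → OnCommonCircuit x z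
  meetingCircuits = go (ℕ.<-wellFounded _)
    where
    -- Eliminate y in both ways.  Unless C₁ ∪ D is smaller than C ∪ D, the circuit C₁
    -- contains C ─ D, which D₁ meets, and C₁ ∪ D₁ misses y.
    go : ∀ {C D x y z} → Acc ℕ._<_ ∣ C ∪ D ∣ → IsCircuit M C → IsCircuit M D →
         x ∈ C → y ∈ C → y ∈ D → z ∈ D → OnCommonCircuit x z
    go {C} {D} {x} {y} {z} (acc rec) c d x∈C y∈C y∈D z∈D with x ∈? D | z ∈? C
    ... | yes x∈D | _       = D , d , x∈D , z∈D
    ... | no  _   | yes z∈C = C , c , x∈C , z∈C
    ... | no  x∉D | no  z∉C = byUnion (C ∪ D ⊆? C₁ ∪ D)
      where
      elim₁ : ∃ λ C₁ → IsCircuit M C₁ × x ∈ C₁ × C₁ ⊆ (C ∪ D) - y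
      elim₁ = strongElimination M c d y∈C y∈D x∈C x∉D
      elim₂ : ∃ λ D₁ → IsCircuit M D₁ × z ∈ D₁ × D₁ ⊆ (D ∪ C) - y
      elim₂ = strongElimination M d c y∈D y∈C z∈D z∉C
      C₁ D₁ : Subset _
      C₁ = proj₁ elim₁
      D₁ = proj₁ elim₂
      c₁ : IsCircuit M C₁
      c₁ = proj₁ (proj₂ elim₁)
      d₁ : IsCircuit M D₁
      d₁ = proj₁ (proj₂ elim₂)
      x∈C₁ : x ∈ C₁
      x∈C₁ = proj₁ (proj₂ (proj₂ elim₁))
      z∈D₁ : z ∈ D₁
      z∈D₁ = proj₁ (proj₂ (proj₂ elim₂))
      C₁⊆ : C₁ ⊆ (C ∪ D) - y
      C₁⊆ = proj₂ (proj₂ (proj₂ elim₁))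
      D₁⊆ : D₁ ⊆ (C ∪ D) - y
      D₁⊆ = subst (λ P → D₁ ⊆ P - y) (∪-comm D C) (proj₂ (proj₂ (proj₂ elim₂)))
      -- A circuit avoiding `y` cannot lie inside `X`, because `X - y` is independent. The element
      -- found outside `X` is where the next pair of circuits meets.
      leaves : ∀ {X C′} → IsCircuit M X → IsCircuit M C′ → y ∈ X → C′ ⊆ (C ∪ D) - y → ∃ λ u → u ∈ C′ × u ∉ X
      leaves {X} {C′} x′ c′ y∈X C′⊆ with Fin.any? (λ u → (u ∈? C′) ×-dec ¬? (u ∈? X))
      ... | yes u = u
      ... | no ∄u = contradiction
        (λ {u} u∈C′ → x∈p∧x≢y⇒x∈p-y (decidable-stable (u ∈? X) (λ u∉X → ∄u (u , u∈C′ , u∉X)))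
                                    (x∈p-y⇒x≢y {p = C ∪ D} (C′⊆ u∈C′)))
        (circuit⊈indep M c′ (circuit-minus M x′ y∈X))
      C₁∪D₁⊆ : C₁ ∪ D₁ ⊆ (C ∪ D) - y
      C₁∪D₁⊆ = ∪-lub {p = C₁} {D₁} {(C ∪ D) - y} C₁⊆ D₁⊆
      C₁∪D⊆ : C₁ ∪ D ⊆ C ∪ D
      C₁∪D⊆ = ∪-lub {p = C₁} {D} {C ∪ D} (λ u∈ → x∈p─q⇒x∈p {p = C ∪ D} {⁅ y ⁆} (C₁⊆ u∈)) (q⊆p∪q C D)
      C₁∪D₁⊂ : C₁ ∪ D₁ ⊂ C ∪ D
      C₁∪D₁⊂ = (λ u∈ → x∈p─q⇒x∈p {p = C ∪ D} {⁅ y ⁆} (C₁∪D₁⊆ u∈)) , y , p⊆p∪q D y∈C ,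
        λ y∈ → x∈p-y⇒x≢y {p = C ∪ D} (C₁∪D₁⊆ y∈) refl
      byUnion : Dec (C ∪ D ⊆ C₁ ∪ D) → OnCommonCircuit x z
      byUnion (no ⊈) =
        let u , u∈C₁ , u∉C = leaves c c₁ y∈C C₁⊆
            u∈D = [ (λ u∈C → contradiction u∈C u∉C) , id ]′
                    (x∈p∪q⁻ C D (x∈p─q⇒x∈p {p = C ∪ D} {⁅ y ⁆} (C₁⊆ u∈C₁)))
        in  go (rec (ℕ.≰⇒> λ ∣C∪D∣≤ → ⊈ (⊆∧∣∣≥⇒⊇ {p = C₁ ∪ D} {C ∪ D} C₁∪D⊆ ∣C∪D∣≤))) c₁ d x∈C₁ u∈C₁ u∈D z∈D
      byUnion (yes C∪D⊆) =
        let u , u∈D₁ , u∉D = leaves d d₁ y∈D D₁⊆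
            u∈C₁ = [ id , (λ u∈D → contradiction u∈D u∉D) ]′
                     (x∈p∪q⁻ C₁ D (C∪D⊆ (x∈p─q⇒x∈p {p = C ∪ D} {⁅ y ⁆} (D₁⊆ u∈D₁))))
        in  go (rec (p⊂q⇒∣p∣<∣q∣ {p = C₁ ∪ D₁} {C ∪ D} C₁∪D₁⊂)) c₁ d₁ x∈C₁ u∈C₁ u∈D₁ z∈D₁

-- Active closures in bipartite graphs

record Bigraph (n : ℕ) : Set₁ where
  infix 4 _~_ _~?_
  field
    S T      : Subset n
    disjoint : ∀ {x} → x ∈ S → x ∉ T
    _~_      : Fin n → Fin n → Set
    _~?_     : ∀ s t → Dec (s ~ t)
    ~⇒∈S     : ∀ {s t} → s ~ t → s ∈ S
    ~⇒∈T     : ∀ {s t} → s ~ t → t ∈ T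

  ~⇒≢ : ∀ {s t} → s ~ t → s ≢ t
  ~⇒≢ s~t refl = disjoint (~⇒∈S s~t) (~⇒∈T s~t)

  ~⇒≮⇒> : ∀ {s t} → s ~ t → ¬ s < t → t < s
  ~⇒≮⇒> {s} {t} s~t s≮t with Fin.<-cmp s t
  ... | tri< s<t _ _ = contradiction s<t s≮t
  ... | tri≈ _ s≡t _ = contradiction s≡t (~⇒≢ s~t)
  ... | tri> _ _ t<s = t<s

transpose : Bigraph n → Bigraph n
transpose Γ = record
  { S = T ; T = S ; disjoint = λ x∈T x∈S → disjoint x∈S x∈T
  ; _~_ = flip _~_ ; _~?_ = flip _~?_ ; ~⇒∈S = ~⇒∈T ; ~⇒∈T = ~⇒∈S }
  where open Bigraph Γ

module _ (Γ : Bigraph n) where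
  open Bigraph Γ

  Active : Fin n → Set
  Active s = s ∈ S × (∀ {t} → s ~ t → s < t)

  HasSmaller : Fin n → Set
  HasSmaller s = ∃ λ t → s ~ t × t < s

  ¬active⇒smaller : ∀ {s} → s ∈ S → ¬ Active s → HasSmaller s
  ¬active⇒smaller {s} s∈S ¬act with Fin.any? (λ t → (s ~? t) ×-dec (t Fin.<? s))
  ... | yes smaller = smaller
  ... | no ∄t = contradiction
    (s∈S , λ {t} s~t → decidable-stable (s Fin.<? t) λ s≮t → ∄t (t , s~t , ~⇒≮⇒> s~t s≮t)) ¬act

  -- The closure conditions of acl, with the neighbours of a member s added
  -- only when they exceed s: the smaller ones are members already.
  data Acl (X : Fin n → Set) : Fin n → Set where
    gen  : ∀ {x} → X x → Acl X x
    up   : ∀ {s} → s ∈ S → HasSmaller s → (∀ {t} → s ~ t → t < s → Acl X t) → Acl X s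
    down : ∀ {s t} → s ~ t → s < t → Acl X s → Acl X t

  Acl-mono : ∀ {X Y : Fin n → Set} → (∀ {x} → X x → Y x) → ∀ {x} → Acl X x → Acl Y x
  Acl-mono X⊆Y (gen Xx)         = gen (X⊆Y Xx)
  Acl-mono X⊆Y (up s∈S sm ts)   = up s∈S sm (λ s~t t<s → Acl-mono X⊆Y (ts s~t t<s))
  Acl-mono X⊆Y (down s~t s<t p) = down s~t s<t (Acl-mono X⊆Y p)

  Acl-empty : ∀ {X : Fin n → Set} → (∀ {x} → ¬ X x) → ∀ {x} → ¬ Acl X x
  Acl-empty ∄X (gen Xx)                     = ∄X Xx
  Acl-empty ∄X (up _ (_ , s~t , t<s) below) = Acl-empty ∄X (below s~t t<s)
  Acl-empty ∄X (down _ _ p)                 = Acl-empty ∄X p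

  -- All premises of a derivation concern smaller elements. Decidability turns the inductive
  -- predicate into a `Subset` and lets a neighbour that fails to join be found by search.
  Acl? : ∀ {X} → Decidable X → Decidable (Acl X)
  Acl? {X} X? x = go x (Fin.<-wellFounded x)
    where
    go : ∀ x → Acc _<_ x → Dec (Acl X x)
    go x (acc rec) with X? x | x ∈? S
    ... | yes Xx | _ = yes (gen Xx)
    ... | no ¬Xx | yes x∈S = map′
      (λ (sm , ts) → up x∈S sm (λ {t} → ts t))
      (λ { (gen Xx)       → contradiction Xx ¬Xx
         ; (up _ sm ts)   → sm , λ t → ts {t}
         ; (down s~x _ _) → contradiction (~⇒∈T s~x) (disjoint x∈S) })
      (Fin.any? (λ t → (x ~? t) ×-dec (t Fin.<? x)) ×-dec Fin.all? below?)
      where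
      below? : ∀ t → Dec (x ~ t → t < x → Acl X t)
      below? t with t Fin.<? x
      ... | yes t<x = (x ~? t) →-dec map′ (λ p _ → p) (λ f → f t<x) (go t (rec t<x))
      ... | no  t≮x = yes λ _ t<x → contradiction t<x t≮x
    ... | no ¬Xx | no x∉S = map′
      (λ (s , s~x , s<x , p) → down s~x s<x p)
      (λ { (gen Xx)           → contradiction Xx ¬Xx
         ; (up x∈S _ _)       → contradiction x∈S x∉S
         ; (down s~x s<x p)   → _ , s~x , s<x , p })
      (Fin.any? below?)
      where
      below? : ∀ s → Dec (s ~ x × s < x × Acl X s)
      below? s with s Fin.<? x
      ... | yes s<x = (s ~? x) ×-dec map′ (s<x ,_) proj₂ (go s (rec s<x))
      ... | no  s≮x = no λ (_ , s<x , _) → s≮x s<x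

  module _ {X : Fin n → Set} (X-active : ∀ {x} → X x → Active x) where

    -- A member of `S` with a smaller neighbour is not a generator, as generators are active; so it
    -- joined by `up`, and that neighbour was a member before it.
    Acl-closed : ∀ {s t} → s ~ t → Acl X s → Acl X t
    Acl-closed {s} {t} s~t p with s Fin.<? t
    ... | yes s<t = down s~t s<t p
    ... | no  s≮t = smaller p
      where
      smaller : Acl X s → Acl X t
      smaller (gen Xs)       = contradiction (proj₂ (X-active Xs) s~t) s≮t
      smaller (up _ _ ts)    = ts s~t (~⇒≮⇒> s~t s≮t)
      smaller (down r~s _ _) = contradiction (~⇒∈T r~s) (disjoint (~⇒∈S s~t))

    Acl⇒∈S⊎∈T : ∀ {x} → Acl X x → x ∈ S ⊎ x ∈ T
    Acl⇒∈S⊎∈T (gen Xx)       = inj₁ (proj₁ (X-active Xx))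
    Acl⇒∈S⊎∈T (up x∈S _ _)   = inj₁ x∈S
    Acl⇒∈S⊎∈T (down s~x _ _) = inj₂ (~⇒∈T s~x)

    -- An active element has no smaller neighbour, so the `HasSmaller` premise of `up` excludes it.
    -- Without that premise every active element would join every closure.
    Acl∩Active : ∀ {x} → Active x → Acl X x → X x
    Acl∩Active act (gen Xx) = Xx
    Acl∩Active act (up _ (t , s~t , t<s) _) = contradiction t<s (Fin.<-asym (proj₂ act s~t))
    Acl∩Active act (down s~x _ _) = contradiction (~⇒∈T s~x) (disjoint (proj₁ act))

  module _ {G : Subset n} (S⊆G : S ⊆ G) (T⊆G : T ⊆ G)
           {Fund : Fin n → Subset n → Set} (fund? : ∀ s → Decidable (Fund s))
           (fund-exists : ∀ {s} → s ∈ S → ∃ (Fund s))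
           (fund⁺ : ∀ {s t C} → Fund s C → s ~ t → t ∈ C)
           (fund⁻ : ∀ {s t C} → s ∈ S → Fund s C → t ∈ C → t ≢ s → s ~ t)
           {X : Subset n} (X-active : ∀ {x} → x ∈ X → Active x) where

    -- The inductive closure, taken as a subset, satisfies the defining conditions, and `acl` is the
    -- least such set. `Fund` is left abstract so that cocircuits serve for the fundamental graph
    -- and circuits for its transpose.
    acl⇒Acl : ∀ {x} → x ∈ Closure.acl G S fund? X → Acl (_∈ X) x
    acl⇒Acl x∈ = ∈-setOf⁻ (Acl (_∈ X)) A? (Closure.acl-least G S fund? X (setOf (Acl (_∈ X)) A?)
      ( (λ y∈ → [ S⊆G , T⊆G ]′ (Acl⇒∈S⊎∈T X-active (∈-setOf⁻ _ A? y∈)))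
      , (λ y∈X → ∈-setOf⁺ _ A? (gen y∈X))
      , (λ s C s∈S s∈ fund {t} t∈C → neighbour s∈S s∈ fund t∈C (t Fin.≟ s))
      , (λ s C s∈S fund (t , t∈) below⊆ →
          let t∈C , t<s = ∈-setOf⁻ _ (λ y → (y ∈? C) ×-dec (y Fin.<? s)) t∈
          in  ∈-setOf⁺ _ A? (up s∈S (t , fund⁻ s∈S fund t∈C (Fin.<⇒≢ t<s) , t<s) λ {u} s~u u<s →
            ∈-setOf⁻ _ A? (below⊆ (∈-setOf⁺ _ (λ y → (y ∈? C) ×-dec (y Fin.<? s)) (fund⁺ fund s~u , u<s))))) ) x∈)
      where
      A? : Decidable (Acl (_∈ X))
      A? = Acl? (_∈? X)
      neighbour : ∀ {s t C} → s ∈ S → s ∈ setOf (Acl (_∈ X)) A? → Fund s C → t ∈ C → Dec (t ≡ s) →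
                  t ∈ setOf (Acl (_∈ X)) A?
      neighbour s∈S s∈ fund t∈C (yes refl) = s∈
      neighbour s∈S s∈ fund t∈C (no t≢s) =
        ∈-setOf⁺ _ A? (Acl-closed X-active (fund⁻ s∈S fund t∈C t≢s) (∈-setOf⁻ _ A? s∈))

    Acl⇒acl : ∀ {x} → Acl (_∈ X) x → x ∈ Closure.acl G S fund? X
    Acl⇒acl p = ∈-setOf⁺ _ (Closure.inEveryClosed? G S fund? X) λ A cl → closed cl p
      where
      closed : ∀ {A x} → Closure.IsClosed G S fund? X A → Acl (_∈ X) x → x ∈ A
      closed (_ , X⊆A , _ , _) (gen x∈X) = X⊆A x∈X
      closed {A} cl@(_ , _ , _ , step) (up {s} s∈S (t , s~t , t<s) ts) =
        let C , fund = fund-exists s∈S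
            ∈C∩<s? = λ y → (y ∈? C) ×-dec (y Fin.<? s)
        in  step s C s∈S fund (t , ∈-setOf⁺ _ ∈C∩<s? (fund⁺ fund s~t , t<s)) λ u∈ →
              let u∈C , u<s = ∈-setOf⁻ _ ∈C∩<s? u∈
              in  closed cl (ts (fund⁻ s∈S fund u∈C (Fin.<⇒≢ u<s)) u<s)
      closed cl@(_ , _ , fund⊆ , _) (down {s} s~t _ q) =
        let C , fund = fund-exists (~⇒∈S s~t)
        in  fund⊆ s C (~⇒∈S s~t) (closed cl q) fund (fund⁺ fund s~t)

-- The closures of the two kinds of active elements are complementary.

module _ (Γ : Bigraph n) where
  open Bigraph Γ
  private Γᵀ = transpose Γ

  -- An `up` on one side against a `down` on the other exhibits a smaller element in both closures.
  -- All other pairs of derivations clash, either between `S` and `T` or with the activity of a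
  -- generator.
  Acl-Active-disjoint : ∀ {x} → Acl Γ (Active Γ) x → ¬ Acl Γᵀ (Active Γᵀ) x
  Acl-Active-disjoint {x} = go (Fin.<-wellFounded x)
    where
    go : ∀ {x} → Acc _<_ x → Acl Γ (Active Γ) x → ¬ Acl Γᵀ (Active Γᵀ) x
    go _ (gen (x∈S , _)) (gen (x∈T , _)) = disjoint x∈S x∈T
    go _ (gen (x∈S , _)) (up x∈T _ _)    = disjoint x∈S x∈T
    go _ (gen (_ , act)) (down x~t t<x _) = Fin.<-asym t<x (act x~t)
    go _ (up x∈S _ _) (gen (x∈T , _)) = disjoint x∈S x∈T
    go _ (up x∈S _ _) (up x∈T _ _)    = disjoint x∈S x∈T
    go (acc rec) (up _ _ ts) (down x~t t<x q) = go (rec t<x) (ts x~t t<x) q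
    go _ (down s~x s<x _) (gen (_ , act)) = Fin.<-asym s<x (act s~x)
    go (acc rec) (down s~x s<x p) (up _ _ ss) = go (rec s<x) p (ss s~x s<x)
    go _ (down s~x _ _) (down x~t _ _) = disjoint (~⇒∈S x~t) (~⇒∈T s~x)

module _ (Γ : Bigraph n) where
  open Bigraph Γ
  private Γᵀ = transpose Γ

  active? : Decidable (Active Γ)
  active? s = map′ (λ (s∈S , f) → s∈S , λ {t} → f t) (λ (s∈S , f) → s∈S , λ t → f {t})
    ((s ∈? S) ×-dec Fin.all? (λ t → (s ~? t) →-dec (s Fin.<? t)))

  -- If `x` is not active, either all its smaller neighbours have joined and `up` applies, or one
  -- has not. By induction that one is in the opposite closure and takes `x` there by `down`.
  Acl-Active-step : ∀ {x} → x ∈ S → (∀ {t} → t < x → t ∈ T → Acl Γ (Active Γ) t ⊎ Acl Γᵀ (Active Γᵀ) t) →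
                    Acl Γ (Active Γ) x ⊎ Acl Γᵀ (Active Γᵀ) x
  Acl-Active-step {x} x∈S ih with active? x
  ... | yes act = inj₁ (gen act)
  ... | no ¬act with Fin.any? (λ t → (x ~? t) ×-dec (t Fin.<? x) ×-dec ¬? (Acl? Γ active? t))
  ...   | no ∄t = inj₁ (up x∈S (¬active⇒smaller Γ x∈S ¬act) λ {t} x~t t<x →
                    decidable-stable (Acl? Γ active? t) λ ¬p → ∄t (t , x~t , t<x , ¬p))
  ...   | yes (t , x~t , t<x , ¬p) with ih t<x (~⇒∈T x~t)
  ...     | inj₁ p = contradiction p ¬p
  ...     | inj₂ q = inj₂ (down x~t t<x q)

module _ (Γ : Bigraph n) where
  open Bigraph Γ
  private Γᵀ = transpose Γ

  Acl-Active-cover : ∀ {x} → x ∈ S ⊎ x ∈ T → Acl Γ (Active Γ) x ⊎ Acl Γᵀ (Active Γᵀ) x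
  Acl-Active-cover {x} = go (Fin.<-wellFounded x)
    where
    go : ∀ {x} → Acc _<_ x → x ∈ S ⊎ x ∈ T → Acl Γ (Active Γ) x ⊎ Acl Γᵀ (Active Γᵀ) x
    go (acc rec) (inj₁ x∈S) = Acl-Active-step Γ x∈S λ t<x t∈T → go (rec t<x) (inj₂ t∈T)
    go (acc rec) (inj₂ x∈T) = Sum.swap (Acl-Active-step Γᵀ x∈T λ s<x s∈S → Sum.swap (go (rec s<x) (inj₁ s∈S)))

-- Chains of sets

module _ {U : Fin (suc m) → Set} (U-dec : ∀ k → Dec (U k)) where

  -- The first drop of `U` at or after `k`. For a decreasing chain of sets it is the step in which
  -- an element lies.
  stepFrom : ∀ k → U k → ¬ U (fromℕ m) → ∃ λ j → toℕ k ℕ.≤ toℕ j × U (inject₁ j) × ¬ U (suc j)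
  stepFrom = go _ U-dec
    where
    go : ∀ m {U : Fin (suc m) → Set} (U-dec : ∀ k → Dec (U k)) k → U k → ¬ U (fromℕ m) →
         ∃ λ j → toℕ k ℕ.≤ toℕ j × U (inject₁ j) × ¬ U (suc j)
    go zero    U-dec zero    u0 ¬u = contradiction u0 ¬u
    go (suc m) U-dec zero    u0 ¬u with U-dec (suc zero)
    ... | no ¬u1 = zero , z≤n , u0 , ¬u1
    ... | yes u1 = let j , _ , uj , ¬uj = go m (U-dec ∘ suc) zero u1 ¬u in suc j , z≤n , uj , ¬uj
    go (suc m) U-dec (suc k) uk ¬u =
      let j , k≤j , uj , ¬uj = go m (U-dec ∘ suc) k uk ¬u in suc j , s≤s k≤j , uj , ¬uj

  stepBefore : ∀ k → U zero → ¬ U k → ∃ λ j → toℕ j ℕ.< toℕ k × U (inject₁ j) × ¬ U (suc j)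
  stepBefore = go _ U-dec
    where
    go : ∀ m {U : Fin (suc m) → Set} (U-dec : ∀ k → Dec (U k)) k → U zero → ¬ U k →
         ∃ λ j → toℕ j ℕ.< toℕ k × U (inject₁ j) × ¬ U (suc j)
    go _       U-dec zero    u0 ¬uk = contradiction u0 ¬uk
    go (suc m) U-dec (suc k) u0 ¬uk with U-dec (suc zero)
    ... | no ¬u1 = zero , s≤s z≤n , u0 , ¬u1
    ... | yes u1 = let j , j<k , uj , ¬uj = go m (U-dec ∘ suc) k u1 ¬uk in suc j , s≤s j<k , uj , ¬uj

antitone : {U : Fin (suc m) → Set} → (∀ k → U (suc k) → U (inject₁ k)) →
           ∀ j k → toℕ j ℕ.≤ toℕ k → U k → U j
antitone           U↓ zero    zero    _         u = u
antitone {m = suc _} {U} U↓ zero    (suc k) _         u = U↓ zero (antitone {U = U ∘ suc} (U↓ ∘ suc) zero k z≤n u)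
antitone {m = suc _} {U} U↓ (suc j) (suc k) (s≤s j≤k) u = antitone {U = U ∘ suc} (U↓ ∘ suc) j k j≤k u

Step : (Fin (suc m) → Fin n → Set) → Fin m → Fin n → Set
Step U k x = U (inject₁ k) x × ¬ U (suc k) x

Increasing : (Fin m → Fin n) → Set
Increasing α = ∀ {j k} → j < k → α j < α k

increasing⇒≤ : {α : Fin m → Fin n} → Increasing α → ∀ {j k} → toℕ j ℕ.≤ toℕ k → α j Fin.≤ α k
increasing⇒≤ {α = α} inc {j} {k} j≤k with Fin.<-cmp j k
... | tri< j<k _ _ = ℕ.<⇒≤ (inc j<k)
... | tri≈ _ refl _ = ℕ.≤-refl
... | tri> _ _ k<j = contradiction j≤k (ℕ.<⇒≱ k<j)

-- Two increasing enumerations of one set both begin with its minimum, and their tails enumerate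
-- what remains. Positions are compared through `toℕ` because the equality of the lengths is itself
-- being proved.
increasing-unique : ∀ {m m′} {α : Fin m → Fin n} {β : Fin m′ → Fin n} → Increasing α → Increasing β →
  (∀ j → ∃ λ j′ → α j ≡ β j′) → (∀ j′ → ∃ λ j → β j′ ≡ α j) →
  m ≡ m′ × (∀ j j′ → toℕ j ≡ toℕ j′ → α j ≡ β j′)
increasing-unique {m = zero}  {zero}   _ _ _ _ = refl , λ ()
increasing-unique {m = zero}  {suc m′} _ _ _ β⊆α with β⊆α zero
... | () , _
increasing-unique {m = suc m} {zero}   _ _ α⊆β _ with α⊆β zero
... | () , _
increasing-unique {m = suc m} {suc m′} {α} {β} α-inc β-inc α⊆β β⊆α =
  cong suc (proj₁ ih) , λ
    { zero    zero     _  → α0≡β0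
    ; (suc j) (suc j′) eq → proj₂ ih j j′ (ℕ.suc-injective eq) }
  where
  ≥0 : ∀ {m} {γ : Fin (suc m) → Fin _} → Increasing γ → ∀ j → γ zero Fin.≤ γ j
  ≥0 inc j = increasing⇒≤ inc z≤n
  α0≡β0 : α zero ≡ β zero
  α0≡β0 = let j′ , α0≡ = α⊆β zero ; j , β0≡ = β⊆α zero in Fin.≤-antisym
    (subst (α zero Fin.≤_) (sym β0≡) (≥0 {γ = α} α-inc j))
    (subst (β zero Fin.≤_) (sym α0≡) (≥0 {γ = β} β-inc j′))
  tail : ∀ {m m′} {γ : Fin (suc m) → Fin _} {δ : Fin (suc m′) → Fin _} → Increasing γ → γ zero ≡ δ zero →
         (∀ j → ∃ λ j′ → γ j ≡ δ j′) → ∀ j → ∃ λ j′ → γ (suc j) ≡ δ (suc j′)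
  tail inc γ0≡δ0 γ⊆δ j with γ⊆δ (suc j)
  ... | zero   , eq = contradiction (trans γ0≡δ0 (sym eq)) (Fin.<⇒≢ (inc {zero} {suc j} (s≤s z≤n)))
  ... | suc j′ , eq = j′ , eq
  ih : m ≡ m′ × (∀ j j′ → toℕ j ≡ toℕ j′ → α (suc j) ≡ β (suc j′))
  ih = increasing-unique (λ j<k → α-inc (s≤s j<k)) (λ j<k → β-inc (s≤s j<k))
    (tail {γ = α} {β} α-inc α0≡β0 α⊆β) (tail {γ = β} {α} β-inc (sym α0≡β0) β⊆α)

-- The increasing enumeration of a finite set.

elements-increasing : (A : Subset n) → Increasing (lookup (elements A))
elements-increasing {suc n} (inside ∷ A) {zero} {suc k} _ =
  subst (zero {n} <_) (sym (lookup-map k suc (elements A))) (s≤s z≤n)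
elements-increasing (inside ∷ A) {suc j} {suc k} (s≤s j<k) =
  subst₂ _<_ (sym (lookup-map j suc (elements A))) (sym (lookup-map k suc (elements A)))
    (s≤s (elements-increasing A j<k))
elements-increasing (outside ∷ A) {j} {k} j<k =
  subst₂ _<_ (sym (lookup-map j suc (elements A))) (sym (lookup-map k suc (elements A)))
    (s≤s (elements-increasing A j<k))

lookup-elements : (A : Subset n) → ∀ j → lookup (elements A) j ∈ A
lookup-elements (inside ∷ A) zero = here
lookup-elements (inside ∷ A) (suc j) =
  subst (_∈ inside ∷ A) (sym (lookup-map j suc (elements A))) (there (lookup-elements A j))
lookup-elements (outside ∷ A) j =
  subst (_∈ outside ∷ A) (sym (lookup-map j suc (elements A))) (there (lookup-elements A j))

∈⇒lookup-elements : ∀ {A : Subset n} {x} → x ∈ A → ∃ λ j → x ≡ lookup (elements A) j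
∈⇒lookup-elements {A = inside  ∷ A} {zero}  _  = zero , refl
∈⇒lookup-elements {A = inside  ∷ A} {suc x} x∈ =
  let j , x≡ = ∈⇒lookup-elements {A = A} (drop-there x∈)
  in  suc j , trans (cong suc x≡) (sym (lookup-map j suc (elements A)))
∈⇒lookup-elements {A = outside ∷ A} {suc x} x∈ =
  let j , x≡ = ∈⇒lookup-elements {A = A} (drop-there x∈)
  in  j , trans (cong suc x≡) (sym (lookup-map j suc (elements A)))

-- Uniactive steps

-- The index has one value more than the domain of `α`: at the last one there are no generators,
-- which matches the end terms `E` and `⊥` of the two chains.
From : (Fin m → Fin n) → Fin (suc m) → Fin n → Set
From α k x = ∃ λ j → toℕ k ℕ.≤ toℕ j × x ≡ α j

module _ (Γ : Bigraph n) where
  open Bigraph Γ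

  -- a is the only active element of the subgraph induced on St.
  record Uniactive (St : Fin n → Set) (a : Fin n) : Set where
    field
      a∈St      : St a
      a∈S       : a ∈ S
      a<t       : ∀ {t} → St t → a ~ t → a < t
      S-smaller : ∀ {s} → St s → s ∈ S → s ≢ a → ∃ λ t → St t × s ~ t × t < s
      T-smaller : ∀ {t} → St t → t ∈ T → ∃ λ s → St s × s ~ t × s < t

  module _ {St : Fin n → Set} {a : Fin n} (St⊆ : ∀ {x} → St x → x ∈ S ⊎ x ∈ T)
           (uni : Uniactive St a) where
    open Uniactive uni

    private
      smaller : ∀ {x} → St x → x ≢ a → ∃ λ y → St y × y < x
      smaller St-x x≢a = [ (λ x∈S → let t , St-t , _ , t<x = S-smaller St-x x∈S x≢a in t , St-t , t<x)
                         , (λ x∈T → let s , St-s , _ , s<x = T-smaller St-x x∈T in s , St-s , s<x)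
                         ]′ (St⊆ St-x)

    -- Any other element has a smaller neighbour in `St`, so descending ends only at `a`. Thus a
    -- condition on the minima of steps is a condition on their active elements.
    uniactive-min : ∀ {x} → St x → a Fin.≤ x
    uniactive-min {x} = go (Fin.<-wellFounded x)
      where
      go : ∀ {x} → Acc _<_ x → St x → a Fin.≤ x
      go {x} (acc rec) St-x with x Fin.≟ a
      ... | yes refl = ℕ.≤-refl
      ... | no  x≢a  = let y , St-y , y<x = smaller St-x x≢a in
        ℕ.<⇒≤ (ℕ.≤-<-trans (go (rec y<x) St-y) y<x)

  module _ {U : Fin (suc m) → Fin n → Set} (U? : ∀ k → Decidable (U k))
           (U⊆ : ∀ {k x} → U k x → x ∈ S ⊎ x ∈ T)
           (U↓ : ∀ k {x} → U (suc k) x → U (inject₁ k) x)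
           (U-last : ∀ {x} → ¬ U (fromℕ m) x)
           (U-closed : ∀ k {s t} → s ~ t → U k s → U k t)
           {α : Fin m → Fin n} (α-inc : Increasing α)
           (uni : ∀ k → Uniactive (Step U k) (α k))
           (outside-smaller : ∀ {s} → s ∈ S → ¬ U zero s → ∃ λ t → ¬ U zero t × s ~ t × t < s)
           where

    private
      open module Uni k = Uniactive (uni k)

      U-antitone : ∀ {j k} → toℕ j ℕ.≤ toℕ k → ∀ {x} → U k x → U j x
      U-antitone {j} {k} j≤k {x} = antitone {U = λ k → U k x} (λ k → U↓ k) j k j≤k

      stepOf : ∀ {k x} → U k x → ∃ λ j → toℕ k ℕ.≤ toℕ j × Step U j x
      stepOf {k} {x} u = stepFrom (λ k → U? k x) k u U-last

      U-bound : ∀ {j x} → U (inject₁ j) x → α j Fin.≤ x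
      U-bound {j} u with stepOf u
      ... | i , j≤i , St = ℕ.≤-trans (increasing⇒≤ α-inc (subst (ℕ._≤ toℕ i) (Fin.toℕ-inject₁ j) j≤i))
                                     (uniactive-min (U⊆ ∘ proj₁) (uni i) St)

    -- All neighbours of `α k` stay in `U (inject₁ k)` by closedness, and since the minima increase,
    -- `α k` is the least element there.
    α-active : ∀ k → Active Γ (α k)
    α-active k = a∈S k , λ {t} α~t → Fin.≤∧≢⇒<
      (U-bound (U-closed (inject₁ k) α~t (proj₁ (a∈St k)))) (~⇒≢ α~t)

    active⇒α : ∀ {x} → Active Γ x → ∃ λ k → x ≡ α k
    active⇒α {x} (x∈S , act) with U? zero x
    ... | no ¬u = let t , _ , x~t , t<x = outside-smaller x∈S ¬u in contradiction t<x (Fin.<-asym (act x~t))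
    ... | yes u with stepOf u
    ...   | k , _ , St with x Fin.≟ α k
    ...     | yes x≡α = k , x≡α
    ...     | no  x≢α = let t , _ , x~t , t<x = S-smaller k St x∈S x≢α in
                        contradiction t<x (Fin.<-asym (act x~t))

    -- Recursion along the order inside the steps: an element of `T` has a smaller neighbour in its
    -- own step, and an element of `S` other than the active one has smaller neighbours, all of
    -- which closedness keeps in `U k`.
    U⇒Acl : ∀ {k x} → U k x → Acl Γ (From α k) x
    U⇒Acl {k} {x} = go (Fin.<-wellFounded x)
      where
      go : ∀ {x} → Acc _<_ x → U k x → Acl Γ (From α k) x
      go {x} (acc rec) u with stepOf u
      ... | i , k≤i , St with U⊆ u
      ...   | inj₂ x∈T = let s , (us , _) , s~x , s<x = T-smaller i St x∈T in
                         down s~x s<x (go (rec s<x) (U-antitone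
                           (subst (toℕ k ℕ.≤_) (sym (Fin.toℕ-inject₁ i)) k≤i) us))
      ...   | inj₁ x∈S with x Fin.≟ α i
      ...     | yes x≡α = gen (i , k≤i , x≡α)
      ...     | no  x≢α = let t , _ , x~t , t<x = S-smaller i St x∈S x≢α in
                          up x∈S (t , x~t , t<x) λ x~t t<x → go (rec t<x) (U-closed k x~t u)

    -- Only `up` could lead out of `U k`. If `s` lies outside `U zero`, or in an earlier step
    -- without being its active element, it has a smaller neighbour that is not in `U k` and hence
    -- has not joined. If `s` is the active element of an earlier step, it is a lower bound of `U k`
    -- and so has no smaller neighbour there.
    Acl⇒U : ∀ {k x} → Acl Γ (From α k) x → U k x
    Acl⇒U {k} (gen (j , k≤j , refl)) =
      U-antitone (subst (toℕ k ℕ.≤_) (sym (Fin.toℕ-inject₁ j)) k≤j) (proj₁ (a∈St j))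
    Acl⇒U {k} (down s~t _ p) = U-closed k s~t (Acl⇒U p)
    Acl⇒U {k} {s} (up s∈S (t , s~t , t<s) ts) = decidable-stable (U? k s) λ ¬us → absurd ¬us (U? zero s)
      where
      absurd : ¬ U k s → Dec (U zero s) → Empty.⊥
      absurd ¬us (no ¬u0) = let r , ¬r , s~r , r<s = outside-smaller s∈S ¬u0 in
        ¬r (U-antitone z≤n (Acl⇒U (ts s~r r<s)))
      absurd ¬us (yes u0) with stepBefore (λ k → U? k s) k u0 ¬us
      ... | j , j<k , St with s Fin.≟ α j
      ...   | no s≢α = let r , (_ , ¬r) , s~r , r<s = S-smaller j St s∈S s≢α in
                       ¬r (U-antitone j<k (Acl⇒U (ts s~r r<s)))
      ...   | yes refl = ℕ.<⇒≱ t<s (U-bound (U-antitone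
                           (subst (ℕ._≤ toℕ k) (sym (Fin.toℕ-inject₁ j)) (ℕ.<⇒≤ j<k)) (Acl⇒U (ts s~t t<s))))

  module _ {α : Fin m → Fin n} (α-inc : Increasing α) (α-active : ∀ j → Active Γ (α j)) where

    From? : ∀ k → Decidable (From α k)
    From? k x = Fin.any? (λ j → (toℕ k ℕ.≤? toℕ j) ×-dec (x Fin.≟ α j))

    From-active : ∀ {k x} → From α k x → Active Γ x
    From-active (j , _ , refl) = α-active j

    Chain : Fin (suc m) → Fin n → Set
    Chain k = Acl Γ (From α k)

    chain? : ∀ k → Decidable (Chain k)
    chain? k = Acl? Γ (From? k)

    chain↓ : ∀ k {x} → Chain (suc k) x → Chain (inject₁ k) x
    chain↓ k = Acl-mono Γ λ (j , k<j , x≡) → j , subst (ℕ._≤ toℕ j) (sym (Fin.toℕ-inject₁ k)) (ℕ.<⇒≤ k<j) , x≡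

    chain-last : ∀ {x} → ¬ Chain (fromℕ m) x
    chain-last = Acl-empty Γ λ (j , m≤j , _) → ℕ.<⇒≱ (Fin.toℕ<n j) (subst (ℕ._≤ toℕ j) (Fin.toℕ-fromℕ m) m≤j)

    -- An element of `S` that joins by `up` at one level but not at the next has a smaller neighbour
    -- with the same behaviour, and an element of `T` inherits such a neighbour from its `down`
    -- step. Hence every element of the step but `α k` has a smaller neighbour within it.
    chain-uniactive : ∀ k → Uniactive (Step Chain k) (α k)
    chain-uniactive k = record
      { a∈St      = gen (k , ℕ.≤-reflexive (Fin.toℕ-inject₁ k) , refl) , α∉
      ; a∈S       = proj₁ (α-active k)
      ; a<t       = λ _ → proj₂ (α-active k)
      ; S-smaller = λ (p , ¬p) s∈S s≢α → S-sm p ¬p s∈S s≢α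
      ; T-smaller = λ (p , ¬p) t∈T → T-sm p ¬p t∈T
      }
      where
      α∉ : ¬ Chain (suc k) (α k)
      α∉ p with Acl∩Active Γ {X = From α (suc k)} From-active (α-active k) p
      ... | j , k<j , αk≡αj = Fin.<⇒≢ (α-inc k<j) αk≡αj
      S-sm : ∀ {s} → Chain (inject₁ k) s → ¬ Chain (suc k) s → s ∈ S → s ≢ α k →
             ∃ λ t → Step Chain k t × s ~ t × t < s
      -- The only generator lost between the two levels is `α k`; any other one still generates the
      -- next closure.
      S-sm (gen (j , k≤j , refl)) ¬p _ s≢α = contradiction
        (gen (j , ℕ.≤∧≢⇒< (subst (ℕ._≤ toℕ j) (Fin.toℕ-inject₁ k) k≤j)
                          (λ eq → s≢α (cong α (sym (Fin.toℕ-injective eq)))) , refl)) ¬p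
      S-sm (down r~s _ _) _ s∈S _ = contradiction (~⇒∈T r~s) (disjoint s∈S)
      S-sm {s} (up _ sm ts) ¬p s∈S _ with Fin.any? (λ t → (s ~? t) ×-dec (t Fin.<? s) ×-dec ¬? (chain? (suc k) t))
      ... | yes (t , s~t , t<s , ¬pt) = t , (ts s~t t<s , ¬pt) , s~t , t<s
      ... | no ∄t = contradiction (up s∈S sm λ {t} s~t t<s →
                      decidable-stable (chain? (suc k) t) λ ¬pt → ∄t (t , s~t , t<s , ¬pt)) ¬p
      T-sm : ∀ {t} → Chain (inject₁ k) t → ¬ Chain (suc k) t → t ∈ T →
             ∃ λ s → Step Chain k s × s ~ t × s < t
      T-sm (gen (j , _ , refl)) _ t∈T = contradiction t∈T (disjoint (proj₁ (α-active j)))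
      T-sm (up t∈S _ _) _ t∈T = contradiction t∈T (disjoint t∈S)
      T-sm (down s~t s<t p) ¬p _ = _ , (p , λ q → ¬p (down s~t s<t q)) , s~t , s<t

-- Counting active elements.

∣p∣≡1⇒singleton : ∀ {p : Subset n} → ∣ p ∣ ≡ 1 → ∃ λ x → x ∈ p × (∀ {y} → y ∈ p → y ≡ x)
∣p∣≡1⇒singleton {p = p} eq = go eq (elements p) (lookup-elements p) ∈⇒lookup-elements
  where
  go : ∀ {k} → k ≡ 1 → (v : Vec (Fin _) k) → (∀ j → lookup v j ∈ p) →
       (∀ {y} → y ∈ p → ∃ λ j → y ≡ lookup v j) → ∃ λ x → x ∈ p × (∀ {y} → y ∈ p → y ≡ x)
  go refl (x ∷ []) v∈p p∈v = x , v∈p zero , λ y∈p → case (p∈v y∈p)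
    where
    case : ∀ {y} → (∃ λ j → y ≡ lookup (x ∷ []) j) → y ≡ x
    case (zero , y≡x) = y≡x

singleton⇒∣p∣≡1 : ∀ {p : Subset n} {x} → x ∈ p → (∀ {y} → y ∈ p → y ≡ x) → ∣ p ∣ ≡ 1
singleton⇒∣p∣≡1 {p = p} {x} x∈p p⊆x = trans (cong ∣_∣ (⊆-antisym {i = p} {⁅ x ⁆}
  (λ y∈p → subst (_∈ ⁅ x ⁆) (sym (p⊆x y∈p)) (x∈⁅x⁆ x))
  (λ y∈ → subst (_∈ p) (sym (x∈⁅y⁆⇒x≡y x y∈)) x∈p))) (∣⁅x⁆∣≡1 x)

module _ (Γ : Bigraph n) {St : Fin n → Set}
         (S⊆St : ∀ {x} → x ∈ Bigraph.S Γ → St x) (T⊆St : ∀ {x} → x ∈ Bigraph.T Γ → St x)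
         {I J : Subset n}
         (I⇒active : ∀ {x} → x ∈ I → Active Γ x) (active⇒I : ∀ {x} → Active Γ x → x ∈ I)
         (J⇒active : ∀ {x} → x ∈ J → Active (transpose Γ) x)
         (active⇒J : ∀ {x} → Active (transpose Γ) x → x ∈ J) where
  open Bigraph Γ

  -- `I` and `J` stand for `Int` and `Ext`, or for these exchanged when the graph is transposed.
  -- Failing to be active means having a smaller neighbour, which is what the record asks of the
  -- remaining elements.
  counts⇒uniactive : ∣ I ∣ ≡ 1 → J ≡ ⊥ → ∃ (Uniactive Γ St)
  counts⇒uniactive ∣I∣≡1 J≡⊥ = let a , a∈I , I⊆a = ∣p∣≡1⇒singleton ∣I∣≡1 in a , record
    { a∈St      = S⊆St (proj₁ (I⇒active a∈I))
    ; a∈S       = proj₁ (I⇒active a∈I)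
    ; a<t       = λ _ → proj₂ (I⇒active a∈I)
    ; S-smaller = λ _ s∈S s≢a → let t , s~t , t<s = ¬active⇒smaller Γ s∈S (λ act → s≢a (I⊆a (active⇒I act)))
                                in  t , T⊆St (~⇒∈T s~t) , s~t , t<s
    ; T-smaller = λ {t} _ t∈T → let s , s~t , s<t = ¬active⇒smaller (transpose Γ) t∈T
                                      (λ act → ∉⊥ (subst (t ∈_) J≡⊥ (active⇒J act)))
                                in  s , S⊆St (~⇒∈S s~t) , s~t , s<t
    }

  uniactive⇒counts : ∀ {a} → Uniactive Γ St a → ∣ I ∣ ≡ 1 × J ≡ ⊥
  uniactive⇒counts {a} uni =
    singleton⇒∣p∣≡1 (active⇒I (a∈S , λ a~t → a<t (T⊆St (~⇒∈T a~t)) a~t))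
      (λ {y} y∈I → decidable-stable (y Fin.≟ a) λ y≢a →
        let y∈S , act = I⇒active y∈I
            t , _ , y~t , t<y = S-smaller (S⊆St y∈S) y∈S y≢a
        in  Fin.<-asym t<y (act y~t)) ,
    Empty-unique λ (y , y∈J) →
      let y∈T , act = J⇒active y∈J
          s , _ , s~y , s<y = T-smaller (T⊆St y∈T) y∈T
      in  Fin.<-asym s<y (act s~y)
    where open Uniactive uni

-- Graphs that agree on a set of vertices.

record SameOn (P : Fin n → Set) (Γ Δ : Bigraph n) : Set where
  private
    module Γ = Bigraph Γ
    module Δ = Bigraph Δ
  field
    S⇒ : ∀ {x} → P x → x ∈ Γ.S → x ∈ Δ.S
    S⇐ : ∀ {x} → P x → x ∈ Δ.S → x ∈ Γ.S
    T⇒ : ∀ {x} → P x → x ∈ Γ.T → x ∈ Δ.T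
    T⇐ : ∀ {x} → P x → x ∈ Δ.T → x ∈ Γ.T
    ~⇒ : ∀ {s t} → P s → P t → s Γ.~ t → s Δ.~ t
    ~⇐ : ∀ {s t} → P s → P t → s Δ.~ t → s Γ.~ t

sameOn-sym : ∀ {P : Fin n → Set} {Γ Δ} → SameOn P Γ Δ → SameOn P Δ Γ
sameOn-sym same = record { S⇒ = S⇐ ; S⇐ = S⇒ ; T⇒ = T⇐ ; T⇐ = T⇒ ; ~⇒ = ~⇐ ; ~⇐ = ~⇒ }
  where open SameOn same

sameOn-transpose : ∀ {P : Fin n → Set} {Γ Δ} → SameOn P Γ Δ → SameOn P (transpose Γ) (transpose Δ)
sameOn-transpose same = record
  { S⇒ = T⇒ ; S⇐ = T⇐ ; T⇒ = S⇒ ; T⇐ = S⇐ ; ~⇒ = flip ~⇒ ; ~⇐ = flip ~⇐ }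
  where open SameOn same

uniactive-cong : ∀ {P Q : Fin n → Set} {Γ Δ a} → SameOn P Γ Δ →
                 (∀ {x} → P x → Q x) → (∀ {x} → Q x → P x) → Uniactive Γ P a → Uniactive Δ Q a
uniactive-cong same P⇒Q Q⇒P uni = record
  { a∈St      = P⇒Q a∈St
  ; a∈S       = S⇒ a∈St a∈S
  ; a<t       = λ Qt a~t → a<t (Q⇒P Qt) (~⇐ a∈St (Q⇒P Qt) a~t)
  ; S-smaller = λ Qs s∈S s≢a → let t , Pt , s~t , t<s = S-smaller (Q⇒P Qs) (S⇐ (Q⇒P Qs) s∈S) s≢a
                               in  t , P⇒Q Pt , ~⇒ (Q⇒P Qs) Pt s~t , t<s
  ; T-smaller = λ Qt t∈T → let s , Ps , s~t , s<t = T-smaller (Q⇒P Qt) (T⇐ (Q⇒P Qt) t∈T)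
                           in  s , P⇒Q Ps , ~⇒ Ps (Q⇒P Qt) s~t , s<t
  }
  where
  open SameOn same
  open Uniactive uni

uniactive-resp : ∀ {P Q : Fin n → Set} {Γ a} → (∀ {x} → P x → Q x) → (∀ {x} → Q x → P x) →
                 Uniactive Γ P a → Uniactive Γ Q a
uniactive-resp = uniactive-cong record
  { S⇒ = λ _ → id ; S⇐ = λ _ → id ; T⇒ = λ _ → id ; T⇐ = λ _ → id ; ~⇒ = λ _ _ → id ; ~⇐ = λ _ _ → id }

-- Every element other than a shares a circuit with a smaller element.
uniactive⇒connected : (M : Matroid n) (Γ : Bigraph n) →
                      (∀ {s t} → Bigraph._~_ Γ s t → OnCommonCircuit M s t) →
                      (∀ {x} → x ∈ E M → x ∈ Bigraph.S Γ ⊎ x ∈ Bigraph.T Γ) →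
                      ∀ {a} → Uniactive Γ (_∈ E M) a → IsConnected M
uniactive⇒connected M Γ ~⇒common E⊆ {a} uni x y x∈E y∈E x≢y
  with toA (Fin.<-wellFounded x) x∈E | toA (Fin.<-wellFounded y) y∈E
  where
  open Bigraph Γ
  open Uniactive uni
  common-sym : ∀ {x y} → OnCommonCircuit M x y → OnCommonCircuit M y x
  common-sym (C , c , x∈C , y∈C) = C , c , y∈C , x∈C
  common-trans : ∀ {x y z} → OnCommonCircuit M x y → OnCommonCircuit M y z → OnCommonCircuit M x z
  common-trans (C , c , x∈C , y∈C) (D , d , y∈D , z∈D) = meetingCircuits M c d x∈C y∈C y∈D z∈D
  toA : ∀ {x} → Acc _<_ x → x ∈ E M → x ≡ a ⊎ OnCommonCircuit M a x
  extend : ∀ {x y} → Acc _<_ y → y ∈ E M → OnCommonCircuit M y x → OnCommonCircuit M a x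
  extend rec y∈E yx with toA rec y∈E
  ... | inj₁ refl = yx
  ... | inj₂ ay   = common-trans ay yx
  toA {x} (acc rec) x∈E with x Fin.≟ a | E⊆ x∈E
  ... | yes x≡a | _ = inj₁ x≡a
  ... | no  x≢a | inj₁ x∈S = let t , t∈E , x~t , t<x = S-smaller x∈E x∈S x≢a in
                             inj₂ (extend (rec t<x) t∈E (common-sym (~⇒common x~t)))
  ... | no  _   | inj₂ x∈T = let s , s∈E , s~x , s<x = T-smaller x∈E x∈T in
                             inj₂ (extend (rec s<x) s∈E (~⇒common s~x))
... | inj₁ refl | inj₁ refl = contradiction refl x≢y
... | inj₁ refl | inj₂ ay   = ay
... | inj₂ (C , c , a∈C , x∈C) | inj₁ refl = C , c , x∈C , a∈C
... | inj₂ (C , c , a∈C , x∈C) | inj₂ (D , d , a∈D , y∈D) = meetingCircuits M c d x∈C a∈C a∈D y∈D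

-- The fundamental graph of a basis.

fundGraph : Matroid n → Subset n → Bigraph n
fundGraph M B = record
  { S = B ; T = E M ─ B ; disjoint = λ x∈B x∈ → x∈p─q⇒x∉q {p = E M} x∈ x∈B
  ; _~_ = Exchange M B
  ; _~?_ = λ b e → (b ∈? B) ×-dec (e ∈? (E M ─ B)) ×-dec indep? M (B - b + e)
  ; ~⇒∈S = proj₁ ; ~⇒∈T = proj₁ ∘ proj₂ }

module _ (M : Matroid n) {B : Subset n} (basis : IsBasis M B) where

  private
    Γ  = fundGraph M B
    Γᵀ = transpose Γ
  open Bigraph Γ using (~⇒≢)

  B⊆E : B ⊆ E M
  B⊆E = indep⊆E M (proj₁ basis)

  E⊆B⊎E─B : ∀ {x} → x ∈ E M → x ∈ B ⊎ x ∈ E M ─ B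
  E⊆B⊎E─B {x} x∈E with x ∈? B
  ... | yes x∈B = inj₁ x∈B
  ... | no  x∉B = inj₂ (x∈p∧x∉q⇒x∈p─q x∈E x∉B)

  B⊎E─B⊆E : ∀ {x} → x ∈ B ⊎ x ∈ E M ─ B → x ∈ E M
  B⊎E─B⊆E = [ B⊆E , p─q⊆p (E M) B ]′

  Int⇒active : ∀ {b} → b ∈ Int M B → Active Γ b
  Int⇒active b∈ with ∈-setOf⁻ _ (isInternallyActive? M B) b∈
  ... | b∈B , C , fund , _ , b≤ = b∈B , λ b~e →
    Fin.≤∧≢⇒< (b≤ _ (∈-fundCocircuit⁺ M basis fund b~e)) (~⇒≢ b~e)

  active⇒Int : ∀ {b} → Active Γ b → b ∈ Int M B
  active⇒Int {b} (b∈B , act) =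
    let C , fund = fundCocircuit M basis b∈B
    in  ∈-setOf⁺ _ (isInternallyActive? M B) (b∈B , C , fund , fundCocircuit∋b M basis fund ,
          λ y y∈C → bound fund y∈C (y Fin.≟ b))
    where
    bound : ∀ {C y} → IsFundCocircuit M B b C → y ∈ C → Dec (y ≡ b) → b Fin.≤ y
    bound fund y∈C (yes refl) = ℕ.≤-refl
    bound fund y∈C (no y≢b)   = ℕ.<⇒≤ (act (∈-fundCocircuit⁻ M basis b∈B fund y∈C y≢b))

  Ext⇒active : ∀ {e} → e ∈ Ext M B → Active Γᵀ e
  Ext⇒active e∈ with ∈-setOf⁻ _ (isExternallyActive? M B) e∈
  ... | e∈E─B , C , fund , _ , e≤ = e∈E─B , λ b~e →
    Fin.≤∧≢⇒< (e≤ _ (∈-fundCircuit⁺ M basis fund b~e)) (≢-sym (~⇒≢ b~e))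

  active⇒Ext : ∀ {e} → Active Γᵀ e → e ∈ Ext M B
  active⇒Ext {e} (e∈E─B , act) =
    let C , fund = fundCircuit M basis e∈E─B
    in  ∈-setOf⁺ _ (isExternallyActive? M B) (e∈E─B , C , fund , fundCircuit∋e M (proj₁ basis) fund ,
          λ y y∈C → bound fund y∈C (y Fin.≟ e))
    where
    bound : ∀ {C y} → IsFundCircuit M B e C → y ∈ C → Dec (y ≡ e) → e Fin.≤ y
    bound fund y∈C (yes refl) = ℕ.≤-refl
    bound fund y∈C (no y≢e)   = ℕ.<⇒≤ (act (∈-fundCircuit⁻ M basis e∈E─B fund y∈C y≢e))

  module _ {X : Subset n} (X-active : ∀ {x} → x ∈ X → Active Γ x) where

    aclInt⇒Acl : ∀ {x} → x ∈ aclInt M B X → Acl Γ (_∈ X) x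
    aclInt⇒Acl = acl⇒Acl Γ B⊆E (p─q⊆p (E M) B) (isFundCocircuit? M B) (fundCocircuit M basis)
      (∈-fundCocircuit⁺ M basis) (∈-fundCocircuit⁻ M basis) X-active

    Acl⇒aclInt : ∀ {x} → Acl Γ (_∈ X) x → x ∈ aclInt M B X
    Acl⇒aclInt = Acl⇒acl Γ B⊆E (p─q⊆p (E M) B) (isFundCocircuit? M B) (fundCocircuit M basis)
      (∈-fundCocircuit⁺ M basis) (∈-fundCocircuit⁻ M basis) X-active

  module _ {X : Subset n} (X-active : ∀ {x} → x ∈ X → Active Γᵀ x) where

    aclExt⇒Acl : ∀ {x} → x ∈ aclExt M B X → Acl Γᵀ (_∈ X) x
    aclExt⇒Acl = acl⇒Acl Γᵀ (p─q⊆p (E M) B) B⊆E (isFundCircuit? M B) (fundCircuit M basis)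
      (∈-fundCircuit⁺ M basis) (∈-fundCircuit⁻ M basis) X-active

    Acl⇒aclExt : ∀ {x} → Acl Γᵀ (_∈ X) x → x ∈ aclExt M B X
    Acl⇒aclExt = Acl⇒acl Γᵀ (p─q⊆p (E M) B) B⊆E (isFundCircuit? M B) (fundCircuit M basis)
      (∈-fundCircuit⁺ M basis) (∈-fundCircuit⁻ M basis) X-active

  uniactiveInternal⁻ : IsUniactiveInternal M B → ∃ (Uniactive Γ (_∈ E M))
  uniactiveInternal⁻ (_ , int , ext) = counts⇒uniactive Γ B⊆E (p─q⊆p (E M) B)
    Int⇒active active⇒Int Ext⇒active active⇒Ext int ext

  uniactiveInternal⁺ : ∀ {a} → Uniactive Γ (_∈ E M) a → IsUniactiveInternal M B
  uniactiveInternal⁺ uni = basis , uniactive⇒counts Γ B⊆E (p─q⊆p (E M) B)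
    Int⇒active active⇒Int Ext⇒active active⇒Ext uni

  uniactiveExternal⁻ : IsUniactiveExternal M B → ∃ (Uniactive Γᵀ (_∈ E M))
  uniactiveExternal⁻ (_ , int , ext) = counts⇒uniactive Γᵀ (p─q⊆p (E M) B) B⊆E
    Ext⇒active active⇒Ext Int⇒active active⇒Int ext int

  uniactiveExternal⁺ : ∀ {a} → Uniactive Γᵀ (_∈ E M) a → IsUniactiveExternal M B
  uniactiveExternal⁺ uni =
    let ext , int = uniactive⇒counts Γᵀ (p─q⊆p (E M) B) B⊆E
          Ext⇒active active⇒Ext Int⇒active active⇒Int uni
    in  basis , int , ext

  exchange⇒common : ∀ {b e} → Exchange M B b e → OnCommonCircuit M b e
  exchange⇒common ex@(_ , e∈ , _) =
    let C , fund = fundCircuit M basis e∈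
    in  C , proj₁ fund , ∈-fundCircuit⁺ M basis fund ex , fundCircuit∋e M (proj₁ basis) fund

  uniactive⇒connectedInt : ∀ {a} → Uniactive Γ (_∈ E M) a → IsConnected M
  uniactive⇒connectedInt = uniactive⇒connected M Γ exchange⇒common E⊆B⊎E─B

  uniactive⇒connectedExt : ∀ {a} → Uniactive Γᵀ (_∈ E M) a → IsConnected M
  uniactive⇒connectedExt = uniactive⇒connected M Γᵀ
    (λ ex → let C , c , b∈C , e∈C = exchange⇒common ex in C , c , e∈C , b∈C) (Sum.swap ∘ E⊆B⊎E─B)

module _ (M : Matroid n) (B : Subset n) where

  -- The internally active element belongs to `B`, so if it is the only element, it is independent.
  uniactiveInternal⇒¬loop : IsUniactiveInternal M B → ¬ IsLoop M
  uniactiveInternal⇒¬loop (basis , int , _) (e , E≡e , c) =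
    let b , b∈Int , _ = ∣p∣≡1⇒singleton int
        b∈B = proj₁ (Int⇒active M basis b∈Int)
        b≡e = x∈⁅y⁆⇒x≡y e (subst (b ∈_) E≡e (B⊆E M basis b∈B))
    in  circuit⊈indep M c (proj₁ basis) λ x∈e → subst (_∈ B) (trans b≡e (sym (x∈⁅y⁆⇒x≡y e x∈e))) b∈B

  uniactiveExternal⇒¬isthmus : IsUniactiveExternal M B → ¬ IsIsthmus M
  uniactiveExternal⇒¬isthmus (basis , _ , ext) (e , E≡e , c) =
    let f , f∈Ext , _ = ∣p∣≡1⇒singleton ext
        f∈ = proj₁ (Ext⇒active M basis f∈Ext)
        f≡e = x∈⁅y⁆⇒x≡y e (subst (f ∈_) E≡e (p─q⊆p (E M) B f∈))
    in  circuit⊈indep (dual M) c (proj₁ (dual-basis M basis))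
          λ x∈e → subst (_∈ E M ─ B) (trans f≡e (sym (x∈⁅y⁆⇒x≡y e x∈e))) f∈

  uniactiveInternal-isthmus : IsUniactiveInternal M B → IsIsthmus M → B ≡ E M
  uniactiveInternal-isthmus (basis , int , _) (e , E≡e , _) =
    let b , b∈Int , _ = ∣p∣≡1⇒singleton int
        b∈B = proj₁ (Int⇒active M basis b∈Int)
        b≡e = x∈⁅y⁆⇒x≡y e (subst (b ∈_) E≡e (B⊆E M basis b∈B))
    in  ⊆-antisym (B⊆E M basis) λ {x} x∈E →
          subst (_∈ B) (trans b≡e (sym (x∈⁅y⁆⇒x≡y e (subst (x ∈_) E≡e x∈E)))) b∈B

  uniactiveExternal-loop : IsUniactiveExternal M B → IsLoop M → B ≡ ⊥
  uniactiveExternal-loop (basis , _ , _) (e , E≡e , c) = Empty-unique λ (x , x∈B) →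
    let x≡e = x∈⁅y⁆⇒x≡y e (subst (x ∈_) E≡e (B⊆E M basis x∈B))
    in  circuit⊈indep M c (proj₁ basis) λ y∈e → subst (_∈ B) (trans x≡e (sym (x∈⁅y⁆⇒x≡y e y∈e))) x∈B

-- Uniactive bases of minors, read in the graph of the whole matroid.

module _ (M : Matroid n) {B A G : Subset n} (basis : IsBasis M B) (A⊆G : A ⊆ G) (G⊆E : G ⊆ E M)
         (A-basis : IsBasis (restrict M A) (B ∩ A)) where

  private
    Γ = fundGraph M B
    N = minor M G A
    B′ = B ∩ (G ─ A)
    E≡ : E N ≡ G ─ A
    E≡ = E-minor M basis A⊆G G⊆E A-basis

  module _ (G-basis : IsBasis (restrict M G) (B ∩ G)) where

    minorGraph : SameOn (_∈ G ─ A) Γ (fundGraph N B′)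
    minorGraph = record
      { S⇒ = λ x∈ x∈B → x∈p∩q⁺ (x∈B , x∈)
      ; S⇐ = λ _ → p∩q⊆p B (G ─ A)
      ; T⇒ = λ {x} x∈ x∈E─B → x∈p∧x∉q⇒x∈p─q (subst (x ∈_) (sym E≡) x∈)
               (x∈p─q⇒x∉q {p = E M} x∈E─B ∘′ p∩q⊆p B (G ─ A))
      ; T⇐ = λ x∈ x∈′ → x∈p∧x∉q⇒x∈p─q (G⊆E (x∈p─q⇒x∈p {p = G} x∈))
               λ x∈B → x∈p─q⇒x∉q {p = E N} x∈′ (x∈p∩q⁺ (x∈B , x∈))
      ; ~⇒ = exchange-minor⁺ M basis A⊆G G⊆E A-basis G-basis
      ; ~⇐ = λ _ _ → exchange-minor⁻ M basis A⊆G G⊆E A-basis G-basis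
      }

    private
      N-basis : IsBasis N B′
      N-basis = minor-basis⁺ M basis A⊆G G⊆E A-basis G-basis
      ⇒E : ∀ {x} → x ∈ G ─ A → x ∈ E N
      ⇒E {x} = subst (x ∈_) (sym E≡)
      E⇒ : ∀ {x} → x ∈ E N → x ∈ G ─ A
      E⇒ {x} = subst (x ∈_) E≡

    minor-uniactiveInternal : ∀ {a} → Uniactive Γ (_∈ G ─ A) a → IsUniactiveInternal N B′ × IsConnected N
    minor-uniactiveInternal uni =
      let uni′ = uniactive-cong minorGraph ⇒E E⇒ uni
      in  uniactiveInternal⁺ N N-basis uni′ , uniactive⇒connectedInt N N-basis uni′

    minor-uniactiveExternal : ∀ {a} → Uniactive (transpose Γ) (_∈ G ─ A) a →
                              IsUniactiveExternal N B′ × IsConnected N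
    minor-uniactiveExternal uni =
      let uni′ = uniactive-cong (sameOn-transpose minorGraph) ⇒E E⇒ uni
      in  uniactiveExternal⁺ N N-basis uni′ , uniactive⇒connectedExt N N-basis uni′

  -- Only `A` is assumed to have the right basis; that of `G` is part of the result, so the
  -- statement can be iterated along a filtration.
  uniactiveInternal-minor : IsUniactiveInternal N B′ →
                            IsBasis (restrict M G) (B ∩ G) × ∃ (Uniactive Γ (_∈ G ─ A))
  uniactiveInternal-minor uni =
    let G-basis = minor-basis⁻ M basis A⊆G G⊆E A-basis (proj₁ uni)
        a , uni′ = uniactiveInternal⁻ N (proj₁ uni) uni
    in  G-basis , a , uniactive-cong (sameOn-sym (minorGraph G-basis)) id id
          (uniactive-resp (λ {x} → subst (x ∈_) E≡) (λ {x} → subst (x ∈_) (sym E≡)) uni′)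

  uniactiveExternal-minor : IsUniactiveExternal N B′ →
                            IsBasis (restrict M G) (B ∩ G) × ∃ (Uniactive (transpose Γ) (_∈ G ─ A))
  uniactiveExternal-minor uni =
    let G-basis = minor-basis⁻ M basis A⊆G G⊆E A-basis (proj₁ uni)
        a , uni′ = uniactiveExternal⁻ N (proj₁ uni) uni
    in  G-basis , a , uniactive-cong (sameOn-sym (sameOn-transpose (minorGraph G-basis))) id id
          (uniactive-resp (λ {x} → subst (x ∈_) E≡) (λ {x} → subst (x ∈_) (sym E≡)) uni′)

-- Filtrations

private variable
  X : Set

lookup-∷ʳ-fromℕ : (v : Vec X m) (z : X) → lookup (v ∷ʳ z) (fromℕ m) ≡ z
lookup-∷ʳ-fromℕ []      z = refl
lookup-∷ʳ-fromℕ (x ∷ v) z = lookup-∷ʳ-fromℕ v z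

lookup-tabulate-∷ʳ : (f : Fin m → X) (z : X) (P : Fin (suc m) → X → Set) →
  (∀ k → P (inject₁ k) (f k)) → P (fromℕ m) z → ∀ k → P k (lookup (tabulate f ∷ʳ z) k)
lookup-tabulate-∷ʳ {zero}  f z P Pf Pz zero    = Pz
lookup-tabulate-∷ʳ {suc m} f z P Pf Pz zero    = Pf zero
lookup-tabulate-∷ʳ {suc m} f z P Pf Pz (suc k) = lookup-tabulate-∷ʳ (f ∘ suc) z (P ∘ suc) (Pf ∘ suc) Pz k

lookup-fromℕ : (v : Vec X (suc m)) → lookup v (fromℕ m) ≡ last v
lookup-fromℕ v with initLast v
... | xs , x , refl = lookup-∷ʳ-fromℕ xs x

lookup-zero : (v : Vec X (suc m)) → lookup v zero ≡ head v
lookup-zero (x ∷ v) = refl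

lookup-ext : {v w : Vec X m} → (∀ k → lookup v k ≡ lookup w k) → v ≡ w
lookup-ext {v = v} {w} eq = trans (sym (tabulate∘lookup v)) (trans (tabulate-cong eq) (tabulate∘lookup w))

sequence-ext : {𝓕 𝓖 : SetSequence n} → ε 𝓕 ≡ ε 𝓖 → ι 𝓕 ≡ ι 𝓖 → Fc 𝓕 ≡ Fc 𝓖 →
               (∀ k k′ → toℕ k ≡ toℕ k′ → lookup (F′ 𝓕) k ≡ lookup (F′ 𝓖) k′) →
               (∀ k k′ → toℕ k ≡ toℕ k′ → lookup (F 𝓕) k ≡ lookup (F 𝓖) k′) → 𝓕 ≡ 𝓖
sequence-ext {𝓕 = setSequence ε ι F′ Fc F} refl refl refl F′≡ F≡ =
  cong₂ (λ V W → setSequence ε ι V Fc W) (lookup-ext λ k → F′≡ k k refl) (lookup-ext λ k → F≡ k k refl)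

From-resp : ∀ {m m′} {α : Fin m → Fin n} {β : Fin m′ → Fin n} → m ≡ m′ →
            (∀ j j′ → toℕ j ≡ toℕ j′ → α j ≡ β j′) →
            ∀ {k k′} → toℕ k ≡ toℕ k′ → ∀ {x} → From α k x → From β k′ x
From-resp refl α≡β k≡k′ (j , k≤j , x≡) = j , subst (ℕ._≤ toℕ j) k≡k′ k≤j , trans x≡ (α≡β j j refl)

isMin-unique : ∀ {A : Subset n} {x y} → IsMin x A → IsMin y A → x ≡ y
isMin-unique (x∈ , x≤) (y∈ , y≤) = Fin.≤-antisym (x≤ _ y∈) (y≤ _ x∈)

-- Sequences described by active closures.

module _ (M : Matroid n) (B : Subset n) where

  -- The enumerations `β` and `γ` list all active elements, and the terms are given by membership in
  -- closures of their tails. Every property of the active filtration is derived from this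
  -- description alone, and so is its uniqueness.
  record IsActiveSequence (𝓖 : SetSequence n) : Set where
    private
      Γ  = fundGraph M B
      Γᵀ = transpose Γ
    field
      β        : Fin (ι 𝓖) → Fin n
      γ        : Fin (ε 𝓖) → Fin n
      β-inc    : Increasing β
      γ-inc    : Increasing γ
      β-active : ∀ j → Active Γ (β j)
      γ-active : ∀ j → Active Γᵀ (γ j)
      active⇒β : ∀ {x} → Active Γ x → ∃ λ j → x ≡ β j
      active⇒γ : ∀ {x} → Active Γᵀ x → ∃ λ j → x ≡ γ j
      ∈F⁻      : ∀ k {x} → x ∈ lookup (F 𝓖) k → x ∈ E M × ¬ Acl Γ (From β k) x
      ∈F⁺      : ∀ k {x} → x ∈ E M → ¬ Acl Γ (From β k) x → x ∈ lookup (F 𝓖) k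
      ∈F′⁻     : ∀ k {x} → x ∈ lookup (F′ 𝓖) k → Acl Γᵀ (From γ k) x
      ∈F′⁺     : ∀ k {x} → Acl Γᵀ (From γ k) x → x ∈ lookup (F′ 𝓖) k
      F′0≡Fc   : lookup (F′ 𝓖) zero ≡ Fc 𝓖

activeSequence-unique : {M : Matroid n} {B : Subset n} {𝓕 𝓖 : SetSequence n} →
                        IsActiveSequence M B 𝓕 → IsActiveSequence M B 𝓖 → 𝓕 ≡ 𝓖
activeSequence-unique {M = M} {B} {𝓕} {𝓖} active𝓕 active𝓖 = sequence-ext (proj₁ γ≡) (proj₁ β≡)
  (trans (sym 𝓕.F′0≡Fc) (trans (F′≡ zero zero refl) 𝓖.F′0≡Fc)) F′≡ F≡
  where
  module 𝓕 = IsActiveSequence active𝓕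
  module 𝓖 = IsActiveSequence active𝓖
  Γ  = fundGraph M B
  Γᵀ = transpose Γ
  β≡ : ι 𝓕 ≡ ι 𝓖 × (∀ j j′ → toℕ j ≡ toℕ j′ → 𝓕.β j ≡ 𝓖.β j′)
  β≡ = increasing-unique 𝓕.β-inc 𝓖.β-inc (𝓖.active⇒β ∘ 𝓕.β-active) (𝓕.active⇒β ∘ 𝓖.β-active)
  γ≡ : ε 𝓕 ≡ ε 𝓖 × (∀ j j′ → toℕ j ≡ toℕ j′ → 𝓕.γ j ≡ 𝓖.γ j′)
  γ≡ = increasing-unique 𝓕.γ-inc 𝓖.γ-inc (𝓖.active⇒γ ∘ 𝓕.γ-active) (𝓕.active⇒γ ∘ 𝓖.γ-active)
  from⇒ : ∀ {m m′} {α : Fin m → Fin _} {δ : Fin m′ → Fin _} →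
          m ≡ m′ × (∀ j j′ → toℕ j ≡ toℕ j′ → α j ≡ δ j′) →
          ∀ {k k′} → toℕ k ≡ toℕ k′ → ∀ {x} → From α k x → From δ k′ x
  from⇒ (m≡ , α≡) = From-resp m≡ α≡
  from⇐ : ∀ {m m′} {α : Fin m → Fin _} {δ : Fin m′ → Fin _} →
          m ≡ m′ × (∀ j j′ → toℕ j ≡ toℕ j′ → α j ≡ δ j′) →
          ∀ {k k′} → toℕ k ≡ toℕ k′ → ∀ {x} → From δ k′ x → From α k x
  from⇐ (m≡ , α≡) k≡k′ = From-resp (sym m≡) (λ j j′ j≡j′ → sym (α≡ j′ j (sym j≡j′))) (sym k≡k′)
  F≡ : ∀ k k′ → toℕ k ≡ toℕ k′ → lookup (F 𝓕) k ≡ lookup (F 𝓖) k′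
  F≡ k k′ k≡k′ = ⊆-antisym
    (λ x∈ → let x∈E , ¬p = 𝓕.∈F⁻ k x∈ in 𝓖.∈F⁺ k′ x∈E (¬p ∘ Acl-mono Γ (from⇐ β≡ {k} {k′} k≡k′)))
    (λ x∈ → let x∈E , ¬p = 𝓖.∈F⁻ k′ x∈ in 𝓕.∈F⁺ k x∈E (¬p ∘ Acl-mono Γ (from⇒ β≡ {k} {k′} k≡k′)))
  F′≡ : ∀ k k′ → toℕ k ≡ toℕ k′ → lookup (F′ 𝓕) k ≡ lookup (F′ 𝓖) k′
  F′≡ k k′ k≡k′ = ⊆-antisym
    (𝓖.∈F′⁺ k′ ∘ Acl-mono Γᵀ (from⇒ γ≡ {k} {k′} k≡k′) ∘ 𝓕.∈F′⁻ k)
    (𝓕.∈F′⁺ k ∘ Acl-mono Γᵀ (from⇐ γ≡ {k} {k′} k≡k′) ∘ 𝓖.∈F′⁻ k′)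

-- Active sequences are connected filtrations.

module _ (M : Matroid n) {B : Subset n} (basis : IsBasis M B) where

  private
    Γ  = fundGraph M B
    Γᵀ = transpose Γ

  module _ {𝓐 : SetSequence n} (active : IsActiveSequence M B 𝓐) where
    open IsActiveSequence active

    private
      F⊆E : ∀ k → lookup (F 𝓐) k ⊆ E M
      F⊆E k = proj₁ ∘ ∈F⁻ k

      F↑ : ∀ k → lookup (F 𝓐) (inject₁ k) ⊆ lookup (F 𝓐) (suc k)
      F↑ k x∈ = let x∈E , ¬p = ∈F⁻ (inject₁ k) x∈ in
        ∈F⁺ (suc k) x∈E λ p → ¬p (chain↓ Γ β-inc β-active k p)

      F′⊆E : ∀ k → lookup (F′ 𝓐) k ⊆ E M
      F′⊆E k x∈ = B⊎E─B⊆E M basis (Sum.swap (Acl⇒∈S⊎∈T Γᵀ (From-active Γᵀ γ-inc γ-active) (∈F′⁻ k x∈)))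

      F′↓ : ∀ k → lookup (F′ 𝓐) (suc k) ⊆ lookup (F′ 𝓐) (inject₁ k)
      F′↓ k x∈ = ∈F′⁺ (inject₁ k) (chain↓ Γᵀ γ-inc γ-active k (∈F′⁻ (suc k) x∈))

      F-uni : ∀ k → Uniactive Γ (_∈ step 𝓐 k) (β k)
      F-uni k = uniactive-resp
        (λ (p , ¬p) → x∈p∧x∉q⇒x∈p─q
          (∈F⁺ (suc k) (B⊎E─B⊆E M basis (Acl⇒∈S⊎∈T Γ (From-active Γ β-inc β-active) p)) ¬p)
          (λ x∈ → proj₂ (∈F⁻ (inject₁ k) x∈) p))
        (λ {x} x∈ → let x∈E , ¬p = ∈F⁻ (suc k) (x∈p─q⇒x∈p {p = lookup (F 𝓐) (suc k)} x∈) in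
          decidable-stable (chain? Γ β-inc β-active (inject₁ k) x)
            (λ ¬q → x∈p─q⇒x∉q {p = lookup (F 𝓐) (suc k)} x∈ (∈F⁺ (inject₁ k) x∈E ¬q)) , ¬p)
        (chain-uniactive Γ β-inc β-active k)

      F′-uni : ∀ k → Uniactive Γᵀ (_∈ step′ 𝓐 k) (γ k)
      F′-uni k = uniactive-resp
        (λ (p , ¬p) → x∈p∧x∉q⇒x∈p─q (∈F′⁺ (inject₁ k) p) (¬p ∘ ∈F′⁻ (suc k)))
        (λ x∈ → ∈F′⁻ (inject₁ k) (x∈p─q⇒x∈p {p = lookup (F′ 𝓐) (inject₁ k)} x∈) ,
                x∈p─q⇒x∉q {p = lookup (F′ 𝓐) (inject₁ k)} x∈ ∘ ∈F′⁺ (suc k))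
        (chain-uniactive Γᵀ γ-inc γ-active k)

      -- The complement of `lookup (F 𝓐) k` in `E M` is an internal closure: a `b` in it would bring
      -- its neighbour `e` along.
      F-basis : ∀ k → IsBasis (restrict M (lookup (F 𝓐) k)) (B ∩ lookup (F 𝓐) k)
      F-basis k = spanned⇒basis M basis λ {b} b~e e∈F → ∈F⁺ k (B⊆E M basis (proj₁ b~e)) λ p →
        proj₂ (∈F⁻ k e∈F) (Acl-closed Γ (From-active Γ β-inc β-active) b~e p)

      F′-basis : ∀ k → IsBasis (restrict M (lookup (F′ 𝓐) k)) (B ∩ lookup (F′ 𝓐) k)
      F′-basis k = spanned⇒basis M basis λ b~e e∈F′ →
        ∈F′⁺ k (Acl-closed Γᵀ (From-active Γᵀ γ-inc γ-active) b~e (∈F′⁻ k e∈F′))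

      F-minor : ∀ k → IsUniactiveInternal (stepMinor 𝓐 M k) (B ∩ step 𝓐 k) × IsConnected (stepMinor 𝓐 M k)
      F-minor k = minor-uniactiveInternal M basis (F↑ k) (F⊆E (suc k))
        (F-basis (inject₁ k)) (F-basis (suc k)) (F-uni k)

      F′-minor : ∀ k → IsUniactiveExternal (stepMinor′ 𝓐 M k) (B ∩ step′ 𝓐 k) × IsConnected (stepMinor′ 𝓐 M k)
      F′-minor k = minor-uniactiveExternal M basis (F′↓ k) (F′⊆E (inject₁ k))
        (F′-basis (suc k)) (F′-basis (inject₁ k)) (F′-uni k)

      step⊆ : ∀ k {x} → x ∈ step 𝓐 k → x ∈ B ⊎ x ∈ E M ─ B
      step⊆ k x∈ = E⊆B⊎E─B M basis (F⊆E (suc k) (x∈p─q⇒x∈p {p = lookup (F 𝓐) (suc k)} x∈))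

      step′⊆ : ∀ k {x} → x ∈ step′ 𝓐 k → x ∈ E M ─ B ⊎ x ∈ B
      step′⊆ k x∈ = Sum.swap (E⊆B⊎E─B M basis (F′⊆E (inject₁ k) (x∈p─q⇒x∈p {p = lookup (F′ 𝓐) (inject₁ k)} x∈)))

      active⇒From0 : ∀ {x} → Active Γ x → From β zero x
      active⇒From0 act = let j , x≡ = active⇒β act in j , z≤n , x≡

      active⇒From0ᵀ : ∀ {x} → Active Γᵀ x → From γ zero x
      active⇒From0ᵀ act = let j , x≡ = active⇒γ act in j , z≤n , x≡

      -- At index zero all active elements generate, so complementarity of the two closures applies.
      F0≡F′0 : lookup (F 𝓐) zero ≡ lookup (F′ 𝓐) zero
      F0≡F′0 = ⊆-antisym
        (λ x∈ → let x∈E , ¬p = ∈F⁻ zero x∈ in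
          [ (λ p → contradiction (Acl-mono Γ active⇒From0 p) ¬p)
          , (λ q → ∈F′⁺ zero (Acl-mono Γᵀ active⇒From0ᵀ q))
          ]′ (Acl-Active-cover Γ (E⊆B⊎E─B M basis x∈E)))
        (λ x∈ → ∈F⁺ zero (F′⊆E zero x∈) λ p → Acl-Active-disjoint Γ
          (Acl-mono Γ (From-active Γ β-inc β-active {zero}) p)
          (Acl-mono Γᵀ (From-active Γᵀ γ-inc γ-active {zero}) (∈F′⁻ zero x∈)))

    active-isFiltration : IsFiltration (E M) 𝓐
    active-isFiltration = record
      { F′-last  = trans (sym (lookup-fromℕ (F′ 𝓐))) (Empty-unique λ (x , x∈) →
          chain-last Γᵀ γ-inc γ-active (∈F′⁻ (fromℕ _) x∈))
      ; F′-chain = λ k → let γ∈ = Uniactive.a∈St (F′-uni k) in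
          F′↓ k , γ k , x∈p─q⇒x∈p {p = lookup (F′ 𝓐) (inject₁ k)} γ∈ , x∈p─q⇒x∉q {p = lookup (F′ 𝓐) (inject₁ k)} γ∈
      ; F′-head  = trans (sym (lookup-zero (F′ 𝓐))) F′0≡Fc
      ; F-head   = trans (sym (lookup-zero (F 𝓐))) (trans F0≡F′0 F′0≡Fc)
      ; F-chain  = λ k → let β∈ = Uniactive.a∈St (F-uni k) in
          F↑ k , β k , x∈p─q⇒x∈p {p = lookup (F 𝓐) (suc k)} β∈ , x∈p─q⇒x∉q {p = lookup (F 𝓐) (suc k)} β∈
      ; F-last   = trans (sym (lookup-fromℕ (F 𝓐))) (⊆-antisym (F⊆E (fromℕ _))
          λ x∈E → ∈F⁺ (fromℕ _) x∈E (chain-last Γ β-inc β-active))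
      ; mins     = λ j k j<k x y min-x min-y → subst₂ _<_
          (isMin-unique (β-min j) min-x) (isMin-unique (β-min k) min-y) (β-inc j<k)
      ; mins′    = λ j k j<k x y min-x min-y → subst₂ _<_
          (isMin-unique (γ-min j) min-x) (isMin-unique (γ-min k) min-y) (γ-inc j<k)
      }
      where
      β-min : ∀ k → IsMin (β k) (step 𝓐 k)
      β-min k = Uniactive.a∈St (F-uni k) , λ y → uniactive-min Γ (step⊆ k) (F-uni k)
      γ-min : ∀ k → IsMin (γ k) (step′ 𝓐 k)
      γ-min k = Uniactive.a∈St (F′-uni k) , λ y → uniactive-min Γᵀ (step′⊆ k) (F′-uni k)

    active-uniactiveSteps : UniactiveSteps M B 𝓐
    active-uniactiveSteps = proj₁ ∘ F-minor , proj₁ ∘ F′-minor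

    active-isConnectedFiltration : IsConnectedFiltration M 𝓐
    active-isConnectedFiltration = record
      { isFiltration = active-isFiltration
      ; connected    = λ k → proj₂ (F-minor k) ,
          uniactiveInternal⇒¬loop (stepMinor 𝓐 M k) (B ∩ step 𝓐 k) (proj₁ (F-minor k))
      ; connected′   = λ k → proj₂ (F′-minor k) ,
          uniactiveExternal⇒¬isthmus (stepMinor′ 𝓐 M k) (B ∩ step′ 𝓐 k) (proj₁ (F′-minor k))
      }

    active-isthmus : ∀ k → IsIsthmus (stepMinor 𝓐 M k) → B ∩ step 𝓐 k ≡ E (stepMinor 𝓐 M k)
    active-isthmus k = uniactiveInternal-isthmus (stepMinor 𝓐 M k) (B ∩ step 𝓐 k) (proj₁ (F-minor k))

    active-loop : ∀ k → IsLoop (stepMinor′ 𝓐 M k) → B ∩ step′ 𝓐 k ≡ ⊥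
    active-loop k = uniactiveExternal-loop (stepMinor′ 𝓐 M k) (B ∩ step′ 𝓐 k) (proj₁ (F′-minor k))

  -- Uniactive steps force the terms of a filtration.

  module _ {𝓕 : SetSequence n} (isFiltration : IsFiltration (E M) 𝓕) (steps : UniactiveSteps M B 𝓕) where
    open IsFiltration isFiltration

    private
      U : Fin (suc (ι 𝓕)) → Fin n → Set
      U k x = x ∈ E M × x ∉ lookup (F 𝓕) k
      U? : ∀ k → Decidable (U k)
      U? k x = (x ∈? E M) ×-dec ¬? (x ∈? lookup (F 𝓕) k)
      V : Fin (suc (ε 𝓕)) → Fin n → Set
      V k x = x ∈ lookup (F′ 𝓕) k
      V? : ∀ k → Decidable (V k)
      V? k x = x ∈? lookup (F′ 𝓕) k

      V-F0 : lookup (F′ 𝓕) zero ≡ lookup (F 𝓕) zero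
      V-F0 = trans (lookup-zero (F′ 𝓕)) (trans F′-head (trans (sym F-head) (sym (lookup-zero (F 𝓕)))))
      F-full : lookup (F 𝓕) (fromℕ (ι 𝓕)) ≡ E M
      F-full = trans (lookup-fromℕ (F 𝓕)) F-last
      F′-empty : lookup (F′ 𝓕) (fromℕ (ε 𝓕)) ≡ ⊥
      F′-empty = trans (lookup-fromℕ (F′ 𝓕)) F′-last

      𝓕⊆E : ∀ k → lookup (F 𝓕) k ⊆ E M
      𝓕⊆E = Fin.>-weakInduction (λ k → lookup (F 𝓕) k ⊆ E M) (⊆-reflexive F-full)
        λ k ⊆E → ⊆E ∘′ proj₁ (F-chain k)
      𝓕′⊆E : ∀ k → lookup (F′ 𝓕) k ⊆ E M
      𝓕′⊆E = Fin.<-weakInduction (λ k → lookup (F′ 𝓕) k ⊆ E M)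
        (𝓕⊆E zero ∘′ ⊆-reflexive V-F0) λ k ⊆E → ⊆E ∘′ proj₁ (F′-chain k)

      fromMinor′ : ∀ k → IsBasis (restrict M (lookup (F′ 𝓕) (suc k))) (B ∩ lookup (F′ 𝓕) (suc k)) →
                   IsBasis (restrict M (lookup (F′ 𝓕) (inject₁ k))) (B ∩ lookup (F′ 𝓕) (inject₁ k)) ×
                   ∃ (Uniactive Γᵀ (_∈ step′ 𝓕 k))
      fromMinor′ k A-basis =
        uniactiveExternal-minor M basis (proj₁ (F′-chain k)) (𝓕′⊆E (inject₁ k)) A-basis (proj₂ steps k)

      -- The induction starts at the last index, where the set is empty, and climbs to `F'₀`. As
      -- `F'₀ = F₀`, `𝓕-basis` continues from there up to `E M`.
      𝓕′-basis : ∀ k → IsBasis (restrict M (lookup (F′ 𝓕) k)) (B ∩ lookup (F′ 𝓕) k)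
      𝓕′-basis = Fin.>-weakInduction (λ k → IsBasis (restrict M (lookup (F′ 𝓕) k)) (B ∩ lookup (F′ 𝓕) k))
        (spanned⇒basis M basis λ {b} {e} _ e∈ → contradiction (subst (e ∈_) F′-empty e∈) ∉⊥)
        λ k → proj₁ ∘ fromMinor′ k

      fromMinor : ∀ k → IsBasis (restrict M (lookup (F 𝓕) (inject₁ k))) (B ∩ lookup (F 𝓕) (inject₁ k)) →
                  IsBasis (restrict M (lookup (F 𝓕) (suc k))) (B ∩ lookup (F 𝓕) (suc k)) ×
                  ∃ (Uniactive Γ (_∈ step 𝓕 k))
      fromMinor k A-basis =
        uniactiveInternal-minor M basis (proj₁ (F-chain k)) (𝓕⊆E (suc k)) A-basis (proj₁ steps k)

      𝓕-basis : ∀ k → IsBasis (restrict M (lookup (F 𝓕) k)) (B ∩ lookup (F 𝓕) k)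
      𝓕-basis = Fin.<-weakInduction (λ k → IsBasis (restrict M (lookup (F 𝓕) k)) (B ∩ lookup (F 𝓕) k))
        (subst (λ A → IsBasis (restrict M A) (B ∩ A)) V-F0 (𝓕′-basis zero))
        λ k → proj₁ ∘ fromMinor k

      α : Fin (ι 𝓕) → Fin n
      α k = proj₁ (proj₂ (fromMinor k (𝓕-basis (inject₁ k))))
      α-uni : ∀ k → Uniactive Γ (_∈ step 𝓕 k) (α k)
      α-uni k = proj₂ (proj₂ (fromMinor k (𝓕-basis (inject₁ k))))
      δ : Fin (ε 𝓕) → Fin n
      δ k = proj₁ (proj₂ (fromMinor′ k (𝓕′-basis (suc k))))
      δ-uni : ∀ k → Uniactive Γᵀ (_∈ step′ 𝓕 k) (δ k)
      δ-uni k = proj₂ (proj₂ (fromMinor′ k (𝓕′-basis (suc k))))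

      α-inc : Increasing α
      α-inc {j} {k} j<k = mins j k j<k _ _ (α-min j) (α-min k)
        where
        α-min : ∀ k → IsMin (α k) (step 𝓕 k)
        α-min k = Uniactive.a∈St (α-uni k) , λ y → uniactive-min Γ
          (λ x∈ → E⊆B⊎E─B M basis (𝓕⊆E (suc k) (x∈p─q⇒x∈p {p = lookup (F 𝓕) (suc k)} x∈))) (α-uni k)
      δ-inc : Increasing δ
      δ-inc {j} {k} j<k = mins′ j k j<k _ _ (δ-min j) (δ-min k)
        where
        δ-min : ∀ k → IsMin (δ k) (step′ 𝓕 k)
        δ-min k = Uniactive.a∈St (δ-uni k) , λ y → uniactive-min Γᵀ
          (λ x∈ → Sum.swap (E⊆B⊎E─B M basis (𝓕′⊆E (inject₁ k) (x∈p─q⇒x∈p {p = lookup (F′ 𝓕) (inject₁ k)} x∈))))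
          (δ-uni k)

      step⇒U : ∀ k {x} → x ∈ step 𝓕 k → Step U k x
      step⇒U k x∈ = let x∈F = x∈p─q⇒x∈p {p = lookup (F 𝓕) (suc k)} x∈ in
        (𝓕⊆E (suc k) x∈F , x∈p─q⇒x∉q {p = lookup (F 𝓕) (suc k)} x∈) , λ (_ , x∉F) → x∉F x∈F
      U⇒step : ∀ k {x} → Step U k x → x ∈ step 𝓕 k
      U⇒step k {x} ((x∈E , x∉) , ¬u) = x∈p∧x∉q⇒x∈p─q
        (decidable-stable (x ∈? lookup (F 𝓕) (suc k)) λ x∉F → ¬u (x∈E , x∉F)) x∉
      step⇒V : ∀ k {x} → x ∈ step′ 𝓕 k → Step V k x
      step⇒V k x∈ = x∈p─q⇒x∈p {p = lookup (F′ 𝓕) (inject₁ k)} x∈ , x∈p─q⇒x∉q {p = lookup (F′ 𝓕) (inject₁ k)} x∈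
      V⇒step : ∀ k {x} → Step V k x → x ∈ step′ 𝓕 k
      V⇒step k (x∈ , x∉) = x∈p∧x∉q⇒x∈p─q x∈ x∉

      U↓ : ∀ k {x} → U (suc k) x → U (inject₁ k) x
      U↓ k (x∈E , x∉) = x∈E , x∉ ∘ proj₁ (F-chain k)
      V↓ : ∀ k {x} → V (suc k) x → V (inject₁ k) x
      V↓ k = proj₁ (F′-chain k)
      U-last : ∀ {x} → ¬ U (fromℕ (ι 𝓕)) x
      U-last {x} (x∈E , x∉) = x∉ (subst (x ∈_) (sym F-full) x∈E)
      V-last : ∀ {x} → ¬ V (fromℕ (ε 𝓕)) x
      V-last {x} x∈ = ∉⊥ (subst (x ∈_) F′-empty x∈)
      U-closed : ∀ k {b e} → Exchange M B b e → U k b → U k e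
      U-closed k b~e@(_ , e∈ , _) (_ , b∉) = p─q⊆p (E M) B e∈ ,
        b∉ ∘ basis⇒spanned M basis (𝓕-basis k) b~e
      V-closed : ∀ k {e b} → Exchange M B b e → V k e → V k b
      V-closed k = basis⇒spanned M basis (𝓕′-basis k)

      inStep : ∀ {x} → U zero x → ∃ λ j → x ∈ step 𝓕 j
      inStep {x} u = let j , _ , st = stepFrom (λ k → U? k x) zero u U-last in j , U⇒step j st
      inStep′ : ∀ {x} → V zero x → ∃ λ j → x ∈ step′ 𝓕 j
      inStep′ {x} v = let j , _ , st = stepFrom (λ k → V? k x) zero v V-last in j , V⇒step j st
      step⇒U0 : ∀ j {x} → x ∈ step 𝓕 j → U zero x
      step⇒U0 j {x} x∈ = antitone {U = λ k → U k x} (λ k → U↓ k) zero (inject₁ j) z≤n (proj₁ (step⇒U j x∈))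
      step⇒V0 : ∀ j {x} → x ∈ step′ 𝓕 j → V zero x
      step⇒V0 j {x} x∈ = antitone {U = λ k → V k x} (λ k → V↓ k) zero (inject₁ j) z≤n (proj₁ (step⇒V j x∈))
      ¬U0⇒V0 : ∀ {x} → x ∈ E M → ¬ U zero x → V zero x
      ¬U0⇒V0 {x} x∈E ¬u = subst (x ∈_) (sym V-F0)
        (decidable-stable (x ∈? lookup (F 𝓕) zero) λ x∉ → ¬u (x∈E , x∉))
      V0⇒¬U0 : ∀ {x} → V zero x → ¬ U zero x
      V0⇒¬U0 {x} v (_ , x∉) = x∉ (subst (x ∈_) V-F0 v)

      -- Such a `b` lies in `F_c`, hence in an external step. In the transposed graph `B` is the
      -- side without active elements, so `b` has a smaller neighbour in the same step.
      outside-smaller : ∀ {b} → b ∈ B → ¬ U zero b → ∃ λ e → ¬ U zero e × Exchange M B b e × e < b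
      outside-smaller b∈B ¬u =
        let j , b∈ = inStep′ (¬U0⇒V0 (B⊆E M basis b∈B) ¬u)
            e , e∈ , b~e , e<b = Uniactive.T-smaller (δ-uni j) b∈ b∈B
        in  e , V0⇒¬U0 (step⇒V0 j e∈) , b~e , e<b
      outside-smallerᵀ : ∀ {e} → e ∈ E M ─ B → ¬ V zero e → ∃ λ b → ¬ V zero b × Exchange M B b e × b < e
      outside-smallerᵀ {e} e∈E─B ¬v =
        let j , e∈ = inStep (p─q⊆p (E M) B e∈E─B , λ e∈F → ¬v (subst (e ∈_) (sym V-F0) e∈F))
            b , b∈ , b~e , b<e = Uniactive.T-smaller (α-uni j) e∈ e∈E─B
        in  b , (λ v → V0⇒¬U0 v (step⇒U0 j b∈)) , b~e , b<e

      U⊆ : ∀ {k x} → U k x → x ∈ B ⊎ x ∈ E M ─ B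
      U⊆ = E⊆B⊎E─B M basis ∘ proj₁
      V⊆ : ∀ {k x} → V k x → x ∈ E M ─ B ⊎ x ∈ B
      V⊆ {k} = Sum.swap ∘ E⊆B⊎E─B M basis ∘ 𝓕′⊆E k

      U-uni : ∀ k → Uniactive Γ (Step U k) (α k)
      U-uni k = uniactive-resp (step⇒U k) (U⇒step k) (α-uni k)
      V-uni : ∀ k → Uniactive Γᵀ (Step V k) (δ k)
      V-uni k = uniactive-resp (step⇒V k) (V⇒step k) (δ-uni k)

    filtration⇒activeSequence : IsActiveSequence M B 𝓕
    filtration⇒activeSequence = record
      { β        = α
      ; γ        = δ
      ; β-inc    = α-inc
      ; γ-inc    = δ-inc
      ; β-active = α-active Γ U? U⊆ U↓ U-last U-closed α-inc U-uni outside-smaller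
      ; γ-active = α-active Γᵀ V? V⊆ V↓ V-last V-closed δ-inc V-uni outside-smallerᵀ
      ; active⇒β = active⇒α Γ U? U⊆ U↓ U-last U-closed α-inc U-uni outside-smaller
      ; active⇒γ = active⇒α Γᵀ V? V⊆ V↓ V-last V-closed δ-inc V-uni outside-smallerᵀ
      ; ∈F⁻      = λ k x∈ → 𝓕⊆E k x∈ , λ p →
          proj₂ (Acl⇒U Γ U? U⊆ U↓ U-last U-closed α-inc U-uni outside-smaller {k} p) x∈
      ; ∈F⁺      = λ k {x} x∈E ¬p → decidable-stable (x ∈? lookup (F 𝓕) k) λ x∉ →
          ¬p (U⇒Acl Γ U? U⊆ U↓ U-last U-closed α-inc U-uni outside-smaller {k} (x∈E , x∉))
      ; ∈F′⁻     = λ k → U⇒Acl Γᵀ V? V⊆ V↓ V-last V-closed δ-inc V-uni outside-smallerᵀ {k}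
      ; ∈F′⁺     = λ k → Acl⇒U Γᵀ V? V⊆ V↓ V-last V-closed δ-inc V-uni outside-smallerᵀ {k}
      ; F′0≡Fc   = trans (lookup-zero (F′ 𝓕)) F′-head
      }

  -- The active filtration is an active sequence.

  private
    IntEnum : Fin ∣ Int M B ∣ → Fin n
    IntEnum = lookup (elements (Int M B))

    ExtEnum : Fin ∣ Ext M B ∣ → Fin n
    ExtEnum = lookup (elements (Ext M B))

    IntEnum-active : ∀ j → Active Γ (IntEnum j)
    IntEnum-active j = Int⇒active M basis (lookup-elements (Int M B) j)

    ExtEnum-active : ∀ j → Active Γᵀ (ExtEnum j)
    ExtEnum-active j = Ext⇒active M basis (lookup-elements (Ext M B) j)

    elementsFrom⇒From : (X : Subset n) → ∀ k {x} → x ∈ elementsFrom X k → From (lookup (elements X)) (inject₁ k) x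
    elementsFrom⇒From X k x∈ =
      let j , k≤j , x≡ = ∈-setOf⁻ _ (λ x → Fin.any? (λ j → (k Fin.≤? j) ×-dec (x Fin.≟ lookup (elements X) j))) x∈
      in  j , subst (ℕ._≤ toℕ j) (sym (Fin.toℕ-inject₁ k)) k≤j , x≡

    From⇒elementsFrom : (X : Subset n) → ∀ k {x} → From (lookup (elements X)) (inject₁ k) x → x ∈ elementsFrom X k
    From⇒elementsFrom X k (j , k≤j , x≡) =
      ∈-setOf⁺ _ (λ x → Fin.any? (λ j → (k Fin.≤? j) ×-dec (x Fin.≟ lookup (elements X) j)))
        (j , subst (ℕ._≤ toℕ j) (Fin.toℕ-inject₁ k) k≤j , x≡)

    Int-from-active : ∀ k {x} → x ∈ elementsFrom (Int M B) k → Active Γ x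
    Int-from-active k x∈ =
      From-active Γ (elements-increasing (Int M B)) IntEnum-active (elementsFrom⇒From (Int M B) k x∈)

    Ext-from-active : ∀ k {x} → x ∈ elementsFrom (Ext M B) k → Active Γᵀ x
    Ext-from-active k x∈ =
      From-active Γᵀ (elements-increasing (Ext M B)) ExtEnum-active (elementsFrom⇒From (Ext M B) k x∈)

    G : Fin ∣ Int M B ∣ → Subset n
    G k = E M ─ aclInt M B (elementsFrom (Int M B) k)

    G′ : Fin ∣ Ext M B ∣ → Subset n
    G′ k = aclExt M B (elementsFrom (Ext M B) k)

    G-mem : ∀ k {x} → (x ∈ G k → x ∈ E M × ¬ Acl Γ (From IntEnum (inject₁ k)) x) ×
                      (x ∈ E M → ¬ Acl Γ (From IntEnum (inject₁ k)) x → x ∈ G k)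
    G-mem k =
      (λ x∈ → p─q⊆p (E M) (aclInt M B (elementsFrom (Int M B) k)) x∈ , λ p →
        x∈p─q⇒x∉q {p = E M} {aclInt M B (elementsFrom (Int M B) k)} x∈
          (Acl⇒aclInt M basis (Int-from-active k) (Acl-mono Γ (From⇒elementsFrom (Int M B) k) p))) ,
      (λ x∈E ¬p → x∈p∧x∉q⇒x∈p─q x∈E λ x∈ →
        ¬p (Acl-mono Γ (elementsFrom⇒From (Int M B) k) (aclInt⇒Acl M basis (Int-from-active k) x∈)))

    G′-mem : ∀ k {x} → (x ∈ G′ k → Acl Γᵀ (From ExtEnum (inject₁ k)) x) ×
                       (Acl Γᵀ (From ExtEnum (inject₁ k)) x → x ∈ G′ k)
    G′-mem k =
      (λ x∈ → Acl-mono Γᵀ (elementsFrom⇒From (Ext M B) k) (aclExt⇒Acl M basis (Ext-from-active k) x∈)) ,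
      (λ p → Acl⇒aclExt M basis (Ext-from-active k) (Acl-mono Γᵀ (From⇒elementsFrom (Ext M B) k) p))

    F-mem : ∀ k {x} → (x ∈ lookup (F (activeFiltration M B)) k → x ∈ E M × ¬ Acl Γ (From IntEnum k) x) ×
                      (x ∈ E M → ¬ Acl Γ (From IntEnum k) x → x ∈ lookup (F (activeFiltration M B)) k)
    F-mem = lookup-tabulate-∷ʳ G (E M)
      (λ k A → ∀ {x} → (x ∈ A → x ∈ E M × ¬ Acl Γ (From IntEnum k) x) ×
                        (x ∈ E M → ¬ Acl Γ (From IntEnum k) x → x ∈ A))
      G-mem ((λ x∈E → x∈E , chain-last Γ (elements-increasing (Int M B)) IntEnum-active) , λ x∈E _ → x∈E)

    F′-mem : ∀ k {x} → (x ∈ lookup (F′ (activeFiltration M B)) k → Acl Γᵀ (From ExtEnum k) x) ×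
                       (Acl Γᵀ (From ExtEnum k) x → x ∈ lookup (F′ (activeFiltration M B)) k)
    F′-mem = lookup-tabulate-∷ʳ G′ ⊥
      (λ k A → ∀ {x} → (x ∈ A → Acl Γᵀ (From ExtEnum k) x) × (Acl Γᵀ (From ExtEnum k) x → x ∈ A))
      G′-mem ((λ x∈⊥ → contradiction x∈⊥ ∉⊥) ,
              λ p → contradiction p (chain-last Γᵀ (elements-increasing (Ext M B)) ExtEnum-active))

    -- Working with memberships also covers the case without externally active elements, where the
    -- left side is the final `⊥` and the right side is the closure of the empty set.
    F′0≡Fc : lookup (F′ (activeFiltration M B)) zero ≡ Fc (activeFiltration M B)
    F′0≡Fc = ⊆-antisym
      (λ x∈ → Acl⇒aclExt M basis (Ext⇒active M basis)
        (Acl-mono Γᵀ (λ { (j , _ , refl) → lookup-elements (Ext M B) j }) (proj₁ (F′-mem zero) x∈)))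
      (λ x∈ → proj₂ (F′-mem zero) (Acl-mono Γᵀ
        (λ x∈Ext → let j , x≡ = ∈⇒lookup-elements x∈Ext in j , z≤n , x≡)
        (aclExt⇒Acl M basis (Ext⇒active M basis) x∈)))

  activeFiltration-active : IsActiveSequence M B (activeFiltration M B)
  activeFiltration-active = record
    { β        = IntEnum
    ; γ        = ExtEnum
    ; β-inc    = elements-increasing (Int M B)
    ; γ-inc    = elements-increasing (Ext M B)
    ; β-active = IntEnum-active
    ; γ-active = ExtEnum-active
    ; active⇒β = ∈⇒lookup-elements ∘ active⇒Int M basis
    ; active⇒γ = ∈⇒lookup-elements ∘ active⇒Ext M basis
    ; ∈F⁻      = λ k → proj₁ (F-mem k)
    ; ∈F⁺      = λ k → proj₂ (F-mem k)
    ; ∈F′⁻     = λ k → proj₁ (F′-mem k)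
    ; ∈F′⁺     = λ k → proj₂ (F′-mem k)
    ; F′0≡Fc   = F′0≡Fc
    }

theorem4p22 : (n : ℕ) (M : Matroid n) (B : Subset n) → IsBasis M B →
    let 𝓐 = activeFiltration M B in
    (IsFiltration (E M) 𝓐 × UniactiveSteps M B 𝓐 ×
    (∀ 𝓕 → IsFiltration (E M) 𝓕 → UniactiveSteps M B 𝓕 → 𝓕 ≡ 𝓐))
    × (IsConnectedFiltration M 𝓐 ×
    (∀ 𝓕 → IsConnectedFiltration M 𝓕 → UniactiveSteps M B 𝓕 → 𝓕 ≡ 𝓐))
    × (∀ k → IsIsthmus (stepMinor 𝓐 M k) → B ∩ step 𝓐 k ≡ E (stepMinor 𝓐 M k))
    × (∀ k → IsLoop (stepMinor′ 𝓐 M k) → B ∩ step′ 𝓐 k ≡ ⊥)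
theorem4p22 n M B basis =
    ( active-isFiltration M basis active , active-uniactiveSteps M basis active
    , λ 𝓕 → unique {𝓕} )
  , ( active-isConnectedFiltration M basis active
    , λ 𝓕 → unique {𝓕} ∘ IsConnectedFiltration.isFiltration )
  , active-isthmus M basis active
  , active-loop M basis active
  where
  active : IsActiveSequence M B (activeFiltration M B)
  active = activeFiltration-active M basis
  unique : ∀ {𝓕} → IsFiltration (E M) 𝓕 → UniactiveSteps M B 𝓕 → 𝓕 ≡ activeFiltration M B
  unique filtration steps = activeSequence-unique (filtration⇒activeSequence M basis filtration steps) active
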